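{- Let $n$ be a primitive non-deficient number with prime factorization $n=p_1^{a_1}p_2^{a_2}\cdots p_k^{a_k}$, where $p_1<p_2<\cdots<p_k$ are primes and all $a_i\ge 1$, and let $S=S(n)$ be its surplus. Then $$T(n)\ \geq\ \log 2-\frac{25}{64p_1}+\frac{S}{2}-\frac{S^2}{4}.$$
   Context: $\sigma(n)$ denotes the sum of the positive divisors of $n$. A positive integer $n$ is non-deficient if $\sigma(n)/n\ge 2$. A primitive non-deficient number is a non-deficient number having no proper divisor that is non-deficient. For a positive integer $n$, $T(n)=\sum_{p\mid n}\frac1p$ and $H(n)=\prod_{p\mid n}\frac{p}{p-1}$, where $p$ runs over the distinct prime divisors of $n$. For non-deficient $n$, the surplus is $S(n)=H(n)-2$. $\log$ is the natural logarithm. -}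

module Defs where

open import Data.Integer.Base as ℤ using (ℤ; +_; -[1+_]; +[1+_])
import Data.Integer.Properties as ℤ
open import Data.Fin.Base as Fin using (Fin)
open import Data.List.Base using (List; filter; foldr; upTo; applyUpTo)
open import Data.List.Relation.Unary.All as All using (All)
open import Data.List.Relation.Unary.All.Properties using (all-filter)
open import Data.Nat.Base as ℕ using (ℕ; zero; suc; _∸_; _^_)
open import Data.Nat.Coprimality using (1-coprimeTo)
open import Data.Nat.Divisibility using (_∣_; _∣?_)
import Data.Nat.ListAction as ℕ
open import Data.Nat.Primality using (Prime; prime?; prime⇒nonZero; prime⇒nonTrivial)
import Data.Nat.Properties as ℕ
open import Data.Product.Base using (_×_; _,_; proj₁)
open import Data.Rational hiding (nonZero)
open import Data.Rational.Literals using (fromℤ)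
open import Data.Rational.Properties
open import Data.Rational.Solver using (module +-*-Solver)
open import Data.Sum.Base using (inj₁; inj₂)
open import Data.Vec.Functional as Vector using (Vector)
open import Relation.Binary.PropositionalEquality
open import Relation.Nullary using (¬_; Dec; yes; no)
open import Relation.Nullary.Decidable using (_×-dec_)

------------------------------------------------------------------------
-- Arithmetic functions

σ : ℕ → ℕ
σ n = ℕ.sum (filter (_∣? n) (applyUpTo suc n))

record NonDeficient (n : ℕ) : Set where
  field
    .{{nonZero}} : ℕ.NonZero n
    abundancy≥2  : + σ n / n ≥ + 2 / 1

record PrimitiveNonDeficient (n : ℕ) : Set where
  field
    nonDeficient : NonDeficient n
    minimal      : ∀ {d} → d ∣ n → d ≢ n → ¬ NonDeficient d

record IsPrimeFactorization (n : ℕ) {k} (p a : Vector ℕ k) : Set where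
  field
    prime      : ∀ i → Prime (p i)
    increasing : ∀ {i j} → i Fin.< j → p i ℕ.< p j
    exponent≥1 : ∀ i → 1 ℕ.≤ a i
    product    : n ≡ Vector.foldr ℕ._*_ 1 (λ i → p i ^ a i)

PrimeDivisorOf : ℕ → ℕ → Set
PrimeDivisorOf n p = Prime p × p ∣ n

primeDivisorOf? : ∀ n p → Dec (PrimeDivisorOf n p)
primeDivisorOf? n p = prime? p ×-dec p ∣? n

primeDivisors : ℕ → List ℕ
primeDivisors n = filter (primeDivisorOf? n) (upTo (suc n))

primeDivisors-correct : ∀ n → All (PrimeDivisorOf n) (primeDivisors n)
primeDivisors-correct n = all-filter (primeDivisorOf? n) (upTo (suc n))

overPrimeDivisors : (∀ {p} → Prime p → ℚ) → ℕ → List ℚ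
overPrimeDivisors f n = All.reduce (λ pd → f (proj₁ pd)) (primeDivisors-correct n)

1/prime : ∀ {p} → Prime p → ℚ
1/prime {p} pr = + 1 / p
  where instance _ = prime⇒nonZero pr

p/[p-1] : ∀ {p} → Prime p → ℚ
p/[p-1] {p} pr = (+ p / (p ∸ 1)) {{ℕ.>-nonZero (ℕ.m<n⇒0<n∸m (ℕ.nonTrivial⇒n>1 p))}}
  where instance _ = prime⇒nonTrivial pr

T : ℕ → ℚ
T n = foldr _+_ 0ℚ (overPrimeDivisors 1/prime n)

H : ℕ → ℚ
H n = foldr _*_ 1ℚ (overPrimeDivisors p/[p-1] n)

surplus : ℕ → ℚ
surplus n = H n - + 2 / 1

------------------------------------------------------------------------
-- Lemmas on ℚ

fromℕ : ℕ → ℚ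
fromℕ n = fromℤ (+ n)

ε : ℕ → ℚ
ε n = + 1 / suc n

private
  fromℤ-/ : ∀ i → i / 1 ≡ fromℤ i
  fromℤ-/ i = ↥p/↧p≡p (fromℤ i)

fromℕ-+ : ∀ m n → fromℕ (m ℕ.+ n) ≡ fromℕ m + fromℕ n
fromℕ-+ m n = sym (trans
  (cong₂ (λ a b → (a ℤ.+ b) / 1) (ℤ.*-identityʳ (+ m)) (ℤ.*-identityʳ (+ n)))
  (fromℤ-/ (+ (m ℕ.+ n))))

fromℕ-* : ∀ m n → fromℕ (m ℕ.* n) ≡ fromℕ m * fromℕ n
fromℕ-* m n = sym (trans (cong (_/ 1) (sym (ℤ.pos-* m n))) (fromℤ-/ (+ (m ℕ.* n))))

fromℕ-pos : ∀ n .{{_ : ℕ.NonZero n}} → Positive (fromℕ n)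
fromℕ-pos (suc n) = _

ε*suc≡1 : ∀ n → ε n * fromℕ (suc n) ≡ 1ℚ
ε*suc≡1 n = trans (cong (_* fromℕ (suc n)) (↥p/↧p≡p (1/ fromℕ (suc n))))
  (*-inverseˡ (fromℕ (suc n)))

*-cancelʳ-≡-pos : ∀ {p q} r .{{_ : Positive r}} → p * r ≡ q * r → p ≡ q
*-cancelʳ-≡-pos r eq = ≤-antisym
  (*-cancelʳ-≤-pos r (≤-reflexive eq)) (*-cancelʳ-≤-pos r (≤-reflexive (sym eq)))

0≤p*p : ∀ p → 0ℚ ≤ p * p
0≤p*p p with ≤-total 0ℚ p
... | inj₁ 0≤p = nonNegative⁻¹ (p * p) {{nonNeg*nonNeg⇒nonNeg p p}}
  where instance _ = nonNegative 0≤p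
... | inj₂ p≤0 = nonNegative⁻¹ (p * p) {{nonPos*nonPos⇒nonPos p p}}
  where instance _ = nonPositive p≤0

≤-by : ∀ {p q} r → 0ℚ ≤ r → q ≡ p + r → p ≤ q
≤-by {p} r 0≤r refl = subst (_≤ p + r) (+-identityʳ p) (+-monoʳ-≤ p 0≤r)

p≤q+r⇒p-q≤r : ∀ {p q r} → p ≤ q + r → p - q ≤ r
p≤q+r⇒p-q≤r {p} {q} {r} p≤q+r = subst (p - q ≤_)
  (solve 2 (λ q r → q :+ r :- q := r) refl q r) (+-monoˡ-≤ (- q) p≤q+r)
  where open +-*-Solver

∣p-q∣≤ : ∀ {p q r} → p ≤ q + r → q ≤ p + r → ∣ p - q ∣ ≤ r
∣p-q∣≤ {p} {q} {r} p≤q+r q≤p+r with ∣p∣≡p∨∣p∣≡-p (p - q)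
... | inj₁ eq = subst (_≤ r) (sym eq) (p≤q+r⇒p-q≤r p≤q+r)
... | inj₂ eq = subst (_≤ r)
  (trans (solve 2 (λ p q → q :- p := :- (p :- q)) refl p q) (sym eq)) (p≤q+r⇒p-q≤r q≤p+r)
  where open +-*-Solver

0≤ε : ∀ n → 0ℚ ≤ ε n
0≤ε n = nonNegative⁻¹ (ε n) {{normalize-nonNeg 1 (suc n)}}

ε-half : ∀ n → ε (n ℕ.+ suc n) + ε (n ℕ.+ suc n) ≡ ε n
ε-half n = *-cancelʳ-≡-pos (fromℕ (suc n)) (begin
  (ε m + ε m) * fromℕ (suc n)              ≡⟨ solve 2 (λ e s → (e :+ e) :* s := e :* (s :+ s)) refl (ε m) (fromℕ (suc n)) ⟩
  ε m * (fromℕ (suc n) + fromℕ (suc n))    ≡⟨ cong (ε m *_) (fromℕ-+ (suc n) (suc n)) ⟨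
  ε m * fromℕ (suc m)                      ≡⟨ ε*suc≡1 m ⟩
  1ℚ                                       ≡⟨ ε*suc≡1 n ⟨
  ε n * fromℕ (suc n)                      ∎)
  where
  open ≡-Reasoning
  open +-*-Solver
  m = n ℕ.+ suc n

------------------------------------------------------------------------
-- Finite sums

∑ : ℕ → (ℕ → ℚ) → ℚ
∑ zero    f = 0ℚ
∑ (suc n) f = ∑ n f + f n

∑-mono : ∀ n {f g} → (∀ i → i ℕ.< n → f i ≤ g i) → ∑ n f ≤ ∑ n g
∑-mono zero    f≤g = ≤-refl
∑-mono (suc n) f≤g = +-mono-≤ (∑-mono n λ i i<n → f≤g i (ℕ.m<n⇒m<1+n i<n)) (f≤g n ℕ.≤-refl)

∑-const : ∀ n c → ∑ n (λ _ → c) ≡ fromℕ n * c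
∑-const zero    c = sym (*-zeroˡ c)
∑-const (suc n) c = begin
  ∑ n (λ _ → c) + c        ≡⟨ cong (_+ c) (∑-const n c) ⟩
  fromℕ n * c + c          ≡⟨ solve 2 (λ n c → n :* c :+ c := (con 1ℚ :+ n) :* c) refl (fromℕ n) c ⟩
  (1ℚ + fromℕ n) * c       ≡⟨ cong (_* c) (fromℕ-+ 1 n) ⟨
  fromℕ (suc n) * c        ∎
  where
  open ≡-Reasoning
  open +-*-Solver

∑-split : ∀ m n f → ∑ (m ℕ.+ n) f ≡ ∑ m f + ∑ n (λ i → f (m ℕ.+ i))
∑-split m zero    f rewrite ℕ.+-identityʳ m = sym (+-identityʳ (∑ m f))
∑-split m (suc n) f rewrite ℕ.+-suc m n | ∑-split m n f = +-assoc (∑ m f) _ _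

∑-blocks : ∀ n m f → ∑ (n ℕ.* m) f ≡ ∑ n (λ i → ∑ m (λ j → f (i ℕ.* m ℕ.+ j)))
∑-blocks zero    m f = refl
∑-blocks (suc n) m f rewrite ℕ.+-comm m (n ℕ.* m) | ∑-split (n ℕ.* m) m f =
  cong (_+ ∑ m (λ j → f (n ℕ.* m ℕ.+ j))) (∑-blocks n m f)

∑-shift : ∀ n f → ∑ n f + f n ≡ f 0 + ∑ n (λ i → f (suc i))
∑-shift zero    f = +-comm 0ℚ (f 0)
∑-shift (suc n) f = trans (cong (_+ f (suc n)) (∑-shift n f)) (+-assoc (f 0) _ _)

------------------------------------------------------------------------
-- Real numbers, as Bishop's regular sequences of rationals

record ℝ : Set where
  field
    approx  : ℕ → ℚ
    regular : ∀ m n → ∣ approx m - approx n ∣ ≤ ε m + ε n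

open ℝ public

fromℚ : ℚ → ℝ
fromℚ q .approx _ = q
fromℚ q .regular m n = subst (_≤ ε m + ε n) (cong ∣_∣ (sym (+-inverseʳ q)))
  (+-mono-≤ (0≤ε m) (0≤ε n))

infixl 6 _+ℝ_ _-ℝ_
infix  4 _≤ℝ_ _≥ℝ_

_+ℝ_ : ℝ → ℝ → ℝ
(x +ℝ y) .approx n = approx x (n ℕ.+ suc n) + approx y (n ℕ.+ suc n)
(x +ℝ y) .regular m n = begin
  ∣ (x′ m + y′ m) - (x′ n + y′ n) ∣      ≡⟨ cong ∣_∣ (solve 4 (λ a b c d → (a :+ b) :- (c :+ d) := (a :- c) :+ (b :- d)) refl (x′ m) (y′ m) (x′ n) (y′ n)) ⟩
  ∣ (x′ m - x′ n) + (y′ m - y′ n) ∣      ≤⟨ ∣p+q∣≤∣p∣+∣q∣ (x′ m - x′ n) (y′ m - y′ n) ⟩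
  ∣ x′ m - x′ n ∣ + ∣ y′ m - y′ n ∣      ≤⟨ +-mono-≤ (regular x (2* m) (2* n)) (regular y (2* m) (2* n)) ⟩
  (ε′ m + ε′ n) + (ε′ m + ε′ n)          ≡⟨ solve 2 (λ a b → (a :+ b) :+ (a :+ b) := (a :+ a) :+ (b :+ b)) refl (ε′ m) (ε′ n) ⟩
  (ε′ m + ε′ m) + (ε′ n + ε′ n)          ≡⟨ cong₂ _+_ (ε-half m) (ε-half n) ⟩
  ε m + ε n                              ∎
  where
  open ≤-Reasoning
  open +-*-Solver
  2*_ : ℕ → ℕ
  2* k = k ℕ.+ suc k
  x′ y′ ε′ : ℕ → ℚ
  x′ k = approx x (2* k)
  y′ k = approx y (2* k)
  ε′ k = ε (2* k)

-ℝ_ : ℝ → ℝ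
(-ℝ x) .approx n = - approx x n
(-ℝ x) .regular m n = subst (_≤ ε m + ε n)
  (trans (sym (∣-p∣≡∣p∣ (approx x m - approx x n)))
         (cong ∣_∣ (solve 2 (λ a b → :- (a :- b) := :- a :- :- b) refl (approx x m) (approx x n))))
  (regular x m n)
  where open +-*-Solver

_-ℝ_ : ℝ → ℝ → ℝ
x -ℝ y = x +ℝ (-ℝ y)

NonNegativeℝ : ℝ → Set
NonNegativeℝ x = ∀ n → - ε n ≤ approx x n

_≤ℝ_ : ℝ → ℝ → Set
x ≤ℝ y = NonNegativeℝ (y -ℝ x)

_≥ℝ_ : ℝ → ℝ → Set
x ≥ℝ y = y ≤ℝ x

------------------------------------------------------------------------
-- The natural logarithm of a positive rational x, as ∫₁ˣ dt/t.
--
-- The integral is the limit of the Riemann sums Σ_{j=1}^N ((x-1)/N) / tⱼ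
-- over the uniform partition tⱼ = 1 + j(x-1)/N.  These are written
-- Σ_{j=1}^N (x-1) / (N tⱼ), where N tⱼ = (N-j) + j x; this also covers
-- x < 1, for which the integral is negative.

module _ (x : ℚ) .{{_ : Positive x}} where

  N*t : ℕ → ℕ → ℚ
  N*t N j = fromℕ (N ∸ j) + fromℕ j * x

  N*t-pos : ∀ N j .{{_ : ℕ.NonZero N}} → Positive (N*t N j)
  N*t-pos N zero    = pos+nonNeg⇒pos (fromℕ N) {{fromℕ-pos N}} (0ℚ * x)
    {{nonNeg*nonNeg⇒nonNeg 0ℚ x {{pos⇒nonNeg x}}}}
  N*t-pos N (suc j) = nonNeg+pos⇒pos (fromℕ (N ∸ suc j)) (fromℕ (suc j) * x)
    {{pos*pos⇒pos (fromℕ (suc j)) x}}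

  term : (N : ℕ) .{{_ : ℕ.NonZero N}} → ℕ → ℚ
  term N j = ((x - 1ℚ) ÷ N*t N j) {{pos⇒nonZero (N*t N j) {{N*t-pos N j}}}}

  riemannSum : (N : ℕ) .{{_ : ℕ.NonZero N}} → ℚ
  riemannSum N = ∑ N (λ i → term N (suc i))

  term-spec : ∀ N j .{{_ : ℕ.NonZero N}} → term N j * N*t N j ≡ x - 1ℚ
  term-spec N j = begin
    (x - 1ℚ) * 1/ t * t    ≡⟨ *-assoc (x - 1ℚ) (1/ t) t ⟩
    (x - 1ℚ) * (1/ t * t)  ≡⟨ cong ((x - 1ℚ) *_) (*-inverseˡ t) ⟩
    (x - 1ℚ) * 1ℚ          ≡⟨ *-identityʳ (x - 1ℚ) ⟩
    x - 1ℚ                 ∎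
    where
    open ≡-Reasoning
    t = N*t N j
    instance _ = pos⇒nonZero t {{N*t-pos N j}}

  N*t-step : ∀ N j d → j ℕ.+ d ℕ.≤ N → N*t N (j ℕ.+ d) ≡ N*t N j + fromℕ d * (x - 1ℚ)
  N*t-step N j d j+d≤N = begin
    fromℕ u + fromℕ (j ℕ.+ d) * x
      ≡⟨ cong (λ z → fromℕ u + z * x) (fromℕ-+ j d) ⟩
    fromℕ u + (fromℕ j + fromℕ d) * x
      ≡⟨ solve 4 (λ u j d x → u :+ (j :+ d) :* x := (u :+ d) :+ j :* x :+ d :* (x :- con 1ℚ)) refl
           (fromℕ u) (fromℕ j) (fromℕ d) x ⟩
    (fromℕ u + fromℕ d) + fromℕ j * x + fromℕ d * (x - 1ℚ)
      ≡⟨ cong (λ z → z + fromℕ j * x + fromℕ d * (x - 1ℚ)) (trans (sym (fromℕ-+ u d)) (cong fromℕ u+d≡)) ⟩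
    fromℕ (N ∸ j) + fromℕ j * x + fromℕ d * (x - 1ℚ) ∎
    where
    open ≡-Reasoning
    open +-*-Solver
    u = N ∸ (j ℕ.+ d)
    u+d≡ : u ℕ.+ d ≡ N ∸ j
    u+d≡ = trans (cong (ℕ._+ d) (sym (ℕ.∸-+-assoc N j d)))
      (ℕ.m∸n+n≡m (ℕ.m+n≤o⇒m≤o∸n d (subst (ℕ._≤ N) (ℕ.+-comm j d) j+d≤N)))

  term-antitone : ∀ N .{{_ : ℕ.NonZero N}} {j k} → j ℕ.≤ k → k ℕ.≤ N → term N k ≤ term N j
  term-antitone N {j} {k} j≤k k≤N =
    *-cancelʳ-≤-pos (A * B) {{pos*pos⇒pos A {{N*t-pos N j}} B {{N*t-pos N k}}}} (begin
      term N k * (A * B)  ≡⟨ solve 3 (λ g a b → g :* (a :* b) := (g :* b) :* a) refl (term N k) A B ⟩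
      (term N k * B) * A  ≡⟨ cong (_* A) (term-spec N k) ⟩
      c * A               ≤⟨ ≤-by (fromℕ d * (c * c)) 0≤dcc cB≡ ⟩
      c * B               ≡⟨ cong (_* B) (term-spec N j) ⟨
      (term N j * A) * B  ≡⟨ *-assoc (term N j) A B ⟩
      term N j * (A * B)  ∎)
    where
    open ≤-Reasoning
    open +-*-Solver
    A = N*t N j
    B = N*t N k
    c = x - 1ℚ
    d = k ∸ j
    j+d≡k : j ℕ.+ d ≡ k
    j+d≡k = ℕ.m+[n∸m]≡n j≤k
    B≡ : B ≡ A + fromℕ d * c
    B≡ = trans (cong (N*t N) (sym j+d≡k)) (N*t-step N j d (subst (ℕ._≤ N) (sym j+d≡k) k≤N))
    cB≡ : c * B ≡ c * A + fromℕ d * (c * c)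
    cB≡ = trans (cong (c *_) B≡)
      (solve 3 (λ c a d → c :* (a :+ d :* c) := c :* a :+ d :* (c :* c)) refl c A (fromℕ d))
    0≤dcc : 0ℚ ≤ fromℕ d * (c * c)
    0≤dcc = nonNegative⁻¹ _ {{nonNeg*nonNeg⇒nonNeg (fromℕ d) (c * c) {{nonNegative (0≤p*p c)}}}}

  N*t-scale : ∀ N M j → N*t (N ℕ.* M) (j ℕ.* M) ≡ fromℕ M * N*t N j
  N*t-scale N M j = begin
    fromℕ (N ℕ.* M ∸ j ℕ.* M) + fromℕ (j ℕ.* M) * x
      ≡⟨ cong (λ z → fromℕ z + fromℕ (j ℕ.* M) * x) (ℕ.*-distribʳ-∸ M N j) ⟨
    fromℕ ((N ∸ j) ℕ.* M) + fromℕ (j ℕ.* M) * x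
      ≡⟨ cong₂ (λ y z → y + z * x) (fromℕ-* (N ∸ j) M) (fromℕ-* j M) ⟩
    fromℕ (N ∸ j) * fromℕ M + fromℕ j * fromℕ M * x
      ≡⟨ solve 4 (λ u m j x → u :* m :+ j :* m :* x := m :* (u :+ j :* x)) refl
           (fromℕ (N ∸ j)) (fromℕ M) (fromℕ j) x ⟩
    fromℕ M * N*t N j ∎
    where
    open ≡-Reasoning
    open +-*-Solver

  term-scale : ∀ N M j .{{_ : ℕ.NonZero N}} .{{_ : ℕ.NonZero (N ℕ.* M)}} →
               fromℕ M * term (N ℕ.* M) (j ℕ.* M) ≡ term N j
  term-scale N M j = *-cancelʳ-≡-pos (N*t N j) {{N*t-pos N j}} (begin
    fromℕ M * g * N*t N j          ≡⟨ solve 3 (λ m g t → m :* g :* t := g :* (m :* t)) refl (fromℕ M) g (N*t N j) ⟩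
    g * (fromℕ M * N*t N j)        ≡⟨ cong (g *_) (N*t-scale N M j) ⟨
    g * N*t (N ℕ.* M) (j ℕ.* M)    ≡⟨ term-spec (N ℕ.* M) (j ℕ.* M) ⟩
    x - 1ℚ                         ≡⟨ term-spec N j ⟨
    term N j * N*t N j             ∎)
    where
    open ≡-Reasoning
    open +-*-Solver
    g = term (N ℕ.* M) (j ℕ.* M)

  module _ (N M : ℕ) .{{_ : ℕ.NonZero N}} .{{_ : ℕ.NonZero (N ℕ.* M)}} where
    private
      L = N ℕ.* M

      block : ℕ → ℚ
      block i = ∑ M (λ j → term L (suc (i ℕ.* M ℕ.+ j)))

      riemannSum-blocks : riemannSum L ≡ ∑ N block
      riemannSum-blocks = ∑-blocks N M (λ i → term L (suc i))

      end≤ : ∀ i j → j ℕ.< M → suc (i ℕ.* M ℕ.+ j) ℕ.≤ suc i ℕ.* M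
      end≤ i j j<M = subst₂ ℕ._≤_ (ℕ.+-suc (i ℕ.* M) j) (ℕ.+-comm (i ℕ.* M) M)
        (ℕ.+-monoʳ-≤ (i ℕ.* M) j<M)

    riemannSum-refine-lower : riemannSum N ≤ riemannSum L
    riemannSum-refine-lower = subst (riemannSum N ≤_) (sym riemannSum-blocks)
      (∑-mono N λ i i<N → subst (_≤ block i)
        (trans (∑-const M _) (term-scale N M (suc i)))
        (∑-mono M λ j j<M → term-antitone L (end≤ i j j<M) (ℕ.*-monoˡ-≤ M i<N)))

    riemannSum-refine-upper : riemannSum L ≤ riemannSum N + (term N 0 - term N N)
    riemannSum-refine-upper = begin
      riemannSum L                               ≡⟨ riemannSum-blocks ⟩
      ∑ N block                                  ≤⟨ ∑-mono N block≤ ⟩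
      ∑ N (term N)                               ≡⟨ solve 2 (λ a b → a := a :+ b :- b) refl (∑ N (term N)) (term N N) ⟩
      ∑ N (term N) + term N N - term N N         ≡⟨ cong (_- term N N) (∑-shift N (term N)) ⟩
      term N 0 + riemannSum N - term N N         ≡⟨ solve 3 (λ a b c → a :+ b :- c := b :+ (a :- c)) refl (term N 0) (riemannSum N) (term N N) ⟩
      riemannSum N + (term N 0 - term N N)       ∎
      where
      open ≤-Reasoning
      open +-*-Solver
      block≤ : ∀ i → i ℕ.< N → block i ≤ term N i
      block≤ i i<N = subst (block i ≤_)
        (trans (∑-const M _) (term-scale N M i))
        (∑-mono M λ j j<M → term-antitone L
          (ℕ.≤-trans (ℕ.m≤m+n (i ℕ.* M) j) (ℕ.n≤1+n _))
          (ℕ.≤-trans (end≤ i j j<M) (ℕ.*-monoˡ-≤ M i<N)))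

  -- A natural number with (x-1)²/x ≤ x + 1/x ≤ rate, so that the Riemann
  -- sum with rate · (n+1) terms is within 1/(n+1) of the integral.
  rate : ℕ
  rate = ℤ.∣ ↥ x ∣ ℕ.+ ↧ₙ x

  terms : ℕ → ℕ
  terms n = rate ℕ.* suc n

  terms-nonZero : ∀ n → ℕ.NonZero (terms n)
  terms-nonZero n = ℕ.m*n≢0 rate (suc n)
    {{ℕ.>-nonZero (ℕ.≤-trans (ℕ.>-nonZero⁻¹ (↧ₙ x)) (ℕ.m≤n+m (↧ₙ x) ℤ.∣ ↥ x ∣))}}

  private
    instance
      _ = pos⇒nonZero x

      terms-instance : ∀ {n} → ℕ.NonZero (terms n)
      terms-instance {n} = terms-nonZero n

  x+1/x≤rate : x + 1/ x ≤ fromℕ rate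
  x+1/x≤rate = subst (x + 1/ x ≤_) (sym (fromℕ-+ ℤ.∣ ↥ x ∣ (↧ₙ x)))
    (+-mono-≤ (≤-numerator x) (1/≤-denominator x))
    where
    ≤-numerator : ∀ q → .{{Positive q}} → q ≤ fromℕ ℤ.∣ ↥ q ∣
    ≤-numerator (mkℚ +[1+ a ] b _) = *≤* (ℤ.*-monoˡ-≤-nonNeg +[1+ a ] (ℤ.+≤+ (ℕ.s≤s ℕ.z≤n)))
    1/≤-denominator : ∀ q → .{{_ : Positive q}} → .{{_ : NonZero q}} → 1/ q ≤ fromℕ (↧ₙ q)
    1/≤-denominator (mkℚ +[1+ a ] b _) = *≤* (ℤ.*-monoˡ-≤-nonNeg +[1+ b ] (ℤ.+≤+ (ℕ.s≤s ℕ.z≤n)))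

  error≤ : ∀ n → term (terms n) 0 - term (terms n) (terms n) ≤ ε n
  error≤ n = *-cancelʳ-≤-pos (fromℕ N) {{fromℕ-pos N}} (begin
    (term N 0 - term N N) * fromℕ N
      ≡⟨ solve 3 (λ a b n → (a :- b) :* n := a :* n :- b :* n) refl (term N 0) (term N N) (fromℕ N) ⟩
    term N 0 * fromℕ N - term N N * fromℕ N
      ≡⟨ cong₂ _-_ first last ⟩
    (x - 1ℚ) - (x - 1ℚ) * 1/ x
      ≡⟨ solve 2 (λ x y → (x :- con 1ℚ) :- (x :- con 1ℚ) :* y := (x :+ y) :- con 1ℚ :- x :* y) refl x (1/ x) ⟩
    (x + 1/ x) - 1ℚ - x * 1/ x
      ≡⟨ cong (λ z → (x + 1/ x) - 1ℚ - z) (*-inverseʳ x) ⟩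
    (x + 1/ x) - 1ℚ - 1ℚ
      ≤⟨ ≤-by (1ℚ + 1ℚ) (nonNegative⁻¹ (1ℚ + 1ℚ))
           (solve 1 (λ s → s := (s :- con 1ℚ :- con 1ℚ) :+ (con 1ℚ :+ con 1ℚ)) refl (x + 1/ x)) ⟩
    x + 1/ x
      ≤⟨ x+1/x≤rate ⟩
    fromℕ rate
      ≡⟨ *-identityʳ (fromℕ rate) ⟨
    fromℕ rate * 1ℚ
      ≡⟨ cong (fromℕ rate *_) (ε*suc≡1 n) ⟨
    fromℕ rate * (ε n * fromℕ (suc n))
      ≡⟨ solve 3 (λ r e s → r :* (e :* s) := e :* (r :* s)) refl (fromℕ rate) (ε n) (fromℕ (suc n)) ⟩
    ε n * (fromℕ rate * fromℕ (suc n))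
      ≡⟨ cong (ε n *_) (fromℕ-* rate (suc n)) ⟨
    ε n * fromℕ N ∎)
    where
    open ≤-Reasoning
    open +-*-Solver
    N = terms n
    first : term N 0 * fromℕ N ≡ x - 1ℚ
    first = trans (cong (term N 0 *_)
      (solve 2 (λ n x → n := n :+ con 0ℚ :* x) refl (fromℕ N) x)) (term-spec N 0)
    N*tN≡ : N*t N N ≡ fromℕ N * x
    N*tN≡ = trans (cong (λ z → fromℕ z + fromℕ N * x) (ℕ.n∸n≡0 N)) (+-identityˡ (fromℕ N * x))
    last : term N N * fromℕ N ≡ (x - 1ℚ) * 1/ x
    last = *-cancelʳ-≡-pos x (trans (*-assoc (term N N) (fromℕ N) x)
      (trans (cong (term N N *_) (sym N*tN≡))
      (trans (term-spec N N)
      (trans (sym (*-identityʳ (x - 1ℚ)))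
      (trans (cong ((x - 1ℚ) *_) (sym (*-inverseˡ x)))
             (sym (*-assoc (x - 1ℚ) (1/ x) x)))))))

  riemannSum-cauchy : ∀ m n → riemannSum (terms m) ≤ riemannSum (terms n) + (ε m + ε n)
  riemannSum-cauchy m n = begin
    riemannSum (terms m)                      ≤⟨ riemannSum-refine-lower (terms m) (terms n) ⟩
    riemannSum (terms m ℕ.* terms n)          ≡⟨ reindex (ℕ.*-comm (terms m) (terms n)) ⟩
    riemannSum (terms n ℕ.* terms m)          ≤⟨ riemannSum-refine-upper (terms n) (terms m) ⟩
    riemannSum (terms n) + (term (terms n) 0 - term (terms n) (terms n))
                                              ≤⟨ +-monoʳ-≤ (riemannSum (terms n)) (error≤ n) ⟩
    riemannSum (terms n) + ε n                ≤⟨ +-monoʳ-≤ (riemannSum (terms n)) (≤-by (ε m) (0≤ε m) (+-comm (ε m) (ε n))) ⟩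
    riemannSum (terms n) + (ε m + ε n)        ∎
    where
    open ≤-Reasoning
    instance
      mn≢0 : ∀ {m n} → ℕ.NonZero (terms m ℕ.* terms n)
      mn≢0 {m} {n} = ℕ.m*n≢0 (terms m) (terms n) 
    reindex : ∀ {M N} .{{_ : ℕ.NonZero M}} .{{_ : ℕ.NonZero N}} → M ≡ N → riemannSum M ≡ riemannSum N
    reindex refl = refl

  log : ℝ
  log .approx n = riemannSum (terms n)
  log .regular m n = ∣p-q∣≤ (riemannSum-cauchy m n)
    (subst (λ e → riemannSum (terms n) ≤ riemannSum (terms m) + e) (+-comm (ε n) (ε m))
      (riemannSum-cauchy n m))

{-# OPTIONS --safe #-}

-- The increment h(Mc) - h(Md) of the harmonic numbers h is a lower Riemann sum for log (c/d), and
-- such increments telescope, so they replace logarithms throughout: with a = ∏ p, b = ∏ (p-1),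
-- H = a/b and s = S/2, the Riemann sum h(2Mb) - h(Mb) of log 2 is h(Ma) - h(Mb) minus
-- h(Ma) - h(2Mb).  The latter is at least s - s².  The former splits into h(M'p) - h(M'(p-1)) over
-- the primes p, each at most 1/p plus an excess of about 1/(2p²), by the discrete form of
-- 2 log x ≤ x - 1/x.  For odd n the excesses sum to at most 25/(64 p₁).
--
-- If n is even, then H = 2 (1+s), where 1+s is the product over the odd p, and s - s² ≤ s/(1+s)
-- = 1 - ∏ (1 - 1/p) ≤ ∑ 1/p over the odd p; the bound log 2 ≤ 1/2 + 25/128 does the rest.

module Submission where

open import Defs
open import Data.Empty using (⊥-elim)
open import Data.Fin using (zero; suc)
open import Data.Integer using (+_)
open import Data.Integer.Properties as ℤ using ()
open import Data.List using (List; []; _∷_; map; foldr)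
open import Data.List.Relation.Unary.All as All using (All; []; _∷_)
open import Data.List.Relation.Unary.All.Properties as All using ()
open import Data.List.Relation.Unary.AllPairs using (AllPairs; []; _∷_)
open import Data.List.Relation.Unary.AllPairs.Properties as AllPairs using ()
open import Data.Nat using (ℕ; suc; zero)
import Data.Nat as ℕ
open import Data.Nat.Divisibility using (_∣_; divides; ∣-refl; ∣m∣n⇒∣m+n; ∣1⇒≡1)
open import Data.Nat.ListAction using (product)
open import Data.Nat.ListAction.Properties using (product≢0)
open import Data.Nat.Primality
import Data.Nat.Properties as ℕ
open import Data.Nat.Solver using () renaming (module +-*-Solver to ℕ-Solver)
open import Data.Product using (_,_; proj₁; ∃)
open import Data.Rational hiding (∣_∣)
open import Data.Rational.Properties
open import Data.Rational.Solver using (module +-*-Solver)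
open import Data.Sum using (_⊎_; inj₁; inj₂)
open import Data.Vec.Functional as Vector using (Vector)
open import Function using (id; _∘_)
open import Relation.Binary.PropositionalEquality
open import Relation.Nullary using (Dec; yes; no)
open import Relation.Nullary.Decidable using (from-yes; from-no)
open +-*-Solver

-- Inequalities and reciprocals in ℚ

0≤* : ∀ {p q} → 0ℚ ≤ p → 0ℚ ≤ q → 0ℚ ≤ p * q
0≤* {p} {q} 0≤p 0≤q = nonNegative⁻¹ (p * q)
  {{nonNeg*nonNeg⇒nonNeg p {{nonNegative 0≤p}} q {{nonNegative 0≤q}}}}

0≤+ : ∀ {p q} → 0ℚ ≤ p → 0ℚ ≤ q → 0ℚ ≤ p + q
0≤+ = +-mono-≤

0≤fromℕ : ∀ n → 0ℚ ≤ fromℕ n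
0≤fromℕ n = nonNegative⁻¹ (fromℕ n)

0≤½ : 0ℚ ≤ ½
0≤½ = nonNegative⁻¹ ½

p≤q⇒0≤q-p : ∀ {p q} → p ≤ q → 0ℚ ≤ q - p
p≤q⇒0≤q-p {p} {q} p≤q = subst (_≤ q - p) (+-inverseʳ p) (+-monoˡ-≤ (- p) p≤q)

p≤p+q : ∀ p {q} → 0ℚ ≤ q → p ≤ p + q
p≤p+q p {q} 0≤q = ≤-by q 0≤q refl

inverse-unique : ∀ {p q} r .{{_ : Positive r}} → p * r ≡ 1ℚ → q * r ≡ 1ℚ → p ≡ q
inverse-unique r pr≡1 qr≡1 = *-cancelʳ-≡-pos r (trans pr≡1 (sym qr≡1))

fromℕ-suc : ∀ n → fromℕ (suc n) ≡ 1ℚ + fromℕ n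
fromℕ-suc = fromℕ-+ 1

fromℕ-mono : ∀ {m n} → m ℕ.≤ n → fromℕ m ≤ fromℕ n
fromℕ-mono {m} {n} m≤n = ≤-by (fromℕ (n ℕ.∸ m)) (0≤fromℕ (n ℕ.∸ m))
  (trans (cong fromℕ (sym (ℕ.m+[n∸m]≡n m≤n))) (fromℕ-+ m (n ℕ.∸ m)))

ε*[1+n]≡1 : ∀ n → ε n * (1ℚ + fromℕ n) ≡ 1ℚ
ε*[1+n]≡1 n = trans (cong (ε n *_) (sym (fromℕ-suc n))) (ε*suc≡1 n)

ε-difference : ∀ m n → ε m - ε n ≡ (fromℕ n - fromℕ m) * (ε m * ε n)
ε-difference m n = begin
  ε m - ε n
    ≡⟨ solve 2 (λ a b → a :- b := con 1ℚ :* a :- con 1ℚ :* b) refl (ε m) (ε n) ⟩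
  1ℚ * ε m - 1ℚ * ε n
    -- The ring solver does not know that `ε` is a reciprocal, so each 1 is first expanded to a
    -- product `ε k * (1ℚ + fromℕ k)`. Later identities between reciprocals are proved in the same
    -- way.
    ≡⟨ cong₂ (λ x y → x * ε m - y * ε n) (ε*[1+n]≡1 n) (ε*[1+n]≡1 m) ⟨
  ε n * (1ℚ + fromℕ n) * ε m - ε m * (1ℚ + fromℕ m) * ε n
    ≡⟨ solve 4 (λ a b m n → b :* (con 1ℚ :+ n) :* a :- a :* (con 1ℚ :+ m) :* b := (n :- m) :* (a :* b)) refl
         (ε m) (ε n) (fromℕ m) (fromℕ n) ⟩
  (fromℕ n - fromℕ m) * (ε m * ε n) ∎
  where open ≡-Reasoning

ε-antitone : ∀ {m n} → m ℕ.≤ n → ε n ≤ ε m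
ε-antitone {m} {n} m≤n = ≤-by ((fromℕ n - fromℕ m) * (ε m * ε n))
  (0≤* (p≤q⇒0≤q-p (fromℕ-mono m≤n)) (0≤* (0≤ε m) (0≤ε n)))
  (trans (solve 2 (λ a b → a := b :+ (a :- b)) refl (ε m) (ε n)) (cong (_+_ (ε n)) (ε-difference m n)))

/≡*ε : ∀ m n → + m / suc n ≡ fromℕ m * ε n
/≡*ε m n = trans
  (cong₂ (λ i d → i / suc d) (sym (ℤ.*-identityʳ (+ m))) (sym (ℕ.+-identityʳ n)))
  (cong (fromℕ m *_) (sym (↥p/↧p≡p (1/ fromℕ (suc n)))))

-- Harmonic numbers and bounds for their increments

h : ℕ → ℚ
h m = ∑ m ε

-- The increment has `e` terms, the least of which is the last, 1/(d + e). The subtraction truncates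
-- only when `d` and `e` are both 0, and then the factor `fromℕ e` removes the term.
h-growth≥ : ∀ d e → h d + fromℕ e * ε (d ℕ.+ e ℕ.∸ 1) ≤ h (d ℕ.+ e)
h-growth≥ d e = begin
  h d + fromℕ e * ε (d ℕ.+ e ℕ.∸ 1)        ≡⟨ cong (_+_ (h d)) (∑-const e _) ⟨
  h d + ∑ e (λ _ → ε (d ℕ.+ e ℕ.∸ 1))      ≤⟨ +-monoʳ-≤ (h d) (∑-mono e λ i i<e →
                                                ε-antitone (ℕ.≤-pred (subst (suc (d ℕ.+ i) ℕ.≤_) (sym (suc-pred i i<e)) (ℕ.+-monoʳ-< d i<e)))) ⟩
  h d + ∑ e (λ i → ε (d ℕ.+ i))            ≡⟨ ∑-split d e ε ⟨
  h (d ℕ.+ e)                              ∎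
  where
  open ≤-Reasoning
  suc-pred : ∀ i → i ℕ.< e → suc (d ℕ.+ e ℕ.∸ 1) ≡ d ℕ.+ e
  suc-pred i i<e = ℕ.m+[n∸m]≡n {1} (ℕ.≤-trans (ℕ.≤-trans (ℕ.s≤s ℕ.z≤n) i<e) (ℕ.m≤n+m e d))

-- The discrete form of 2 log x ≤ x - 1/x.
h-growth≤ : ∀ d e → h (suc d ℕ.+ e) ≤
  h (suc d) + ½ * (fromℕ (suc d ℕ.+ e) * ε d - fromℕ (suc d) * ε (d ℕ.+ e))
h-growth≤ d zero rewrite ℕ.+-identityʳ d = p≤p+q (h (suc d))
  (≤-reflexive (solve 1 (λ x → con 0ℚ := con ½ :* (x :- x)) refl (fromℕ (suc d) * ε d)))
h-growth≤ d (suc e) rewrite ℕ.+-suc d e = begin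
  h c + C′
    ≤⟨ +-monoˡ-≤ C′ (h-growth≤ d e) ⟩
  h (suc d) + ½ * (x * D - y * C) + C′
    -- Passing from `e` to `suc e` raises the bound by ½ (D + y (C - C′)). This exceeds the new term
    -- `C′` by half of the nonnegative product added here.
    ≤⟨ +-monoˡ-≤ C′ (p≤p+q (h (suc d) + ½ * (x * D - y * C)) (0≤* 0≤½ 0≤r)) ⟩
  h (suc d) + ½ * (x * D - y * C) + ½ * (D * C * C′ * ((x - y) * (x - y) + x)) + C′
    ≡⟨ solve 7 (λ H x y D C C′ r → H :+ con ½ :* (x :* D :- y :* C) :+ con ½ :* r :+ C′
         := H :+ con ½ :* (x :* D :- y :* C :+ r :+ (C′ :+ C′))) refl (h (suc d)) x y D C C′ _ ⟩
  h (suc d) + ½ * (x * D - y * C + D * C * C′ * ((x - y) * (x - y) + x) + (C′ + C′))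
    ≡⟨ cong (λ z → h (suc d) + ½ * z) step ⟩
  h (suc d) + ½ * ((1ℚ + x) * D - y * C′)
    ≡⟨ cong (λ z → h (suc d) + ½ * (z * D - y * C′)) (fromℕ-suc c) ⟨
  h (suc d) + ½ * (fromℕ (suc c) * D - y * C′) ∎
  where
  open ≤-Reasoning
  c = suc (d ℕ.+ e)
  x = fromℕ c
  y = fromℕ (suc d)
  C = ε (d ℕ.+ e)
  C′ = ε c
  D = ε d
  0≤r : 0ℚ ≤ D * C * C′ * ((x - y) * (x - y) + x)
  0≤r = 0≤* (0≤* (0≤* (0≤ε d) (0≤ε (d ℕ.+ e))) (0≤ε c)) (0≤+ (0≤p*p (x - y)) (0≤fromℕ c))
  Dy≡1 : D * y ≡ 1ℚ
  Dy≡1 = ε*suc≡1 d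
  Cx≡1 : C * x ≡ 1ℚ
  Cx≡1 = ε*suc≡1 (d ℕ.+ e)
  C′x≡ : C′ * (1ℚ + x) ≡ 1ℚ
  C′x≡ = ε*[1+n]≡1 c
  -- D C C′ ((x - y)² + x) = D + y (C - C′) - 2 C′
  step : x * D - y * C + D * C * C′ * ((x - y) * (x - y) + x) + (C′ + C′) ≡ (1ℚ + x) * D - y * C′
  step = ≡.begin
    x * D - y * C + D * C * C′ * ((x - y) * (x - y) + x) + (C′ + C′)
      ≡.≡⟨ solve 5 (λ x y D C C′ →
         x :* D :- y :* C :+ D :* C :* C′ :* ((x :- y) :* (x :- y) :+ x) :+ (C′ :+ C′)
         := x :* D :- y :* C :+ (D :* (C :* x) :* (C′ :* (con 1ℚ :+ x)) :+ (D :* y) :* (y :* (C :* (C′ :* (con 1ℚ :+ x)) :- (C :* x) :* C′)) :- (D :* y) :* (C :* x) :* (C′ :+ C′)) :+ (C′ :+ C′))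
         refl x y D C C′ ⟩
    x * D - y * C + (D * (C * x) * (C′ * (1ℚ + x)) + (D * y) * (y * (C * (C′ * (1ℚ + x)) - (C * x) * C′)) - (D * y) * (C * x) * (C′ + C′)) + (C′ + C′)
      ≡.≡⟨ cong₂ (λ u v → x * D - y * C + (D * u * v + (D * y) * (y * (C * v - u * C′)) - (D * y) * u * (C′ + C′)) + (C′ + C′)) Cx≡1 C′x≡ ⟩
    x * D - y * C + (D * 1ℚ * 1ℚ + (D * y) * (y * (C * 1ℚ - 1ℚ * C′)) - (D * y) * 1ℚ * (C′ + C′)) + (C′ + C′)
      ≡.≡⟨ cong (λ u → x * D - y * C + (D * 1ℚ * 1ℚ + u * (y * (C * 1ℚ - 1ℚ * C′)) - u * 1ℚ * (C′ + C′)) + (C′ + C′)) Dy≡1 ⟩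
    x * D - y * C + (D * 1ℚ * 1ℚ + 1ℚ * (y * (C * 1ℚ - 1ℚ * C′)) - 1ℚ * 1ℚ * (C′ + C′)) + (C′ + C′)
      ≡.≡⟨ solve 5 (λ x y D C C′ → x :* D :- y :* C :+ (D :* con 1ℚ :* con 1ℚ :+ con 1ℚ :* (y :* (C :* con 1ℚ :- con 1ℚ :* C′)) :- con 1ℚ :* con 1ℚ :* (C′ :+ C′)) :+ (C′ :+ C′)
         := (con 1ℚ :+ x) :* D :- y :* C′) refl x y D C C′ ⟩
    (1ℚ + x) * D - y * C′ ≡.∎
    where module ≡ = ≡-Reasoning

-- The discrete form of log x ≥ 1 - 1/x at x = c/d.
h-lower : ∀ {c d C} .{{_ : ℕ.NonZero d}} → C * fromℕ c ≡ 1ℚ → d ℕ.≤ c →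
          h d + (1ℚ - fromℕ d * C) ≤ h c
h-lower {c} {d@(suc d-1)} {C} Cc≡1 d≤c with c ℕ.∸ d | ℕ.m+[n∸m]≡n d≤c
... | e | refl = subst (_≤ h (d ℕ.+ e)) (cong (_+_ (h d)) (begin
  fromℕ e * ε (d-1 ℕ.+ e)
    ≡⟨ cong (fromℕ e *_) (inverse-unique {ε (d-1 ℕ.+ e)} {C} (fromℕ (d ℕ.+ e)) (ε*suc≡1 (d-1 ℕ.+ e)) Cc≡1) ⟩
  fromℕ e * C
    ≡⟨ solve 3 (λ d e C → e :* C := C :* (d :+ e) :- d :* C) refl (fromℕ d) (fromℕ e) C ⟩
  C * (fromℕ d + fromℕ e) - fromℕ d * C
    ≡⟨ cong (λ z → C * z - fromℕ d * C) (fromℕ-+ d e) ⟨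
  C * fromℕ (d ℕ.+ e) - fromℕ d * C
    ≡⟨ cong (_- fromℕ d * C) Cc≡1 ⟩
  1ℚ - fromℕ d * C ∎)) (h-growth≥ d e)
  where open ≡-Reasoning

-- This is `h-growth≤` with reciprocals given by their defining equations instead of as values of
-- `ε`, so that a product such as `μ * ε q` can serve as one.
h-upper : ∀ {c d C D} .{{_ : ℕ.NonZero d}} → C * fromℕ c ≡ 1ℚ → D * fromℕ d ≡ 1ℚ → d ℕ.≤ c →
          h c ≤ h d + ½ * (fromℕ c * D - fromℕ d * C)
h-upper {c} {d@(suc d-1)} {C} {D} Cc≡1 Dd≡1 d≤c with c ℕ.∸ d | ℕ.m+[n∸m]≡n d≤c
... | e | refl = subst₂ (λ x y → h (d ℕ.+ e) ≤ h d + ½ * (fromℕ (d ℕ.+ e) * x - fromℕ d * y))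
  (inverse-unique {ε d-1} {D} (fromℕ d) (ε*suc≡1 d-1) Dd≡1)
  (inverse-unique {ε (d-1 ℕ.+ e)} {C} (fromℕ (d ℕ.+ e)) (ε*suc≡1 (d-1 ℕ.+ e)) Cc≡1)
  (h-growth≤ d-1 e)

-- The trapezoid rule for 1/t on [q + 1, q + 2]. It equals ½ (x - 1/x) at x = (q + 2)/(q + 1), which
-- is the bound of `h-upper`.
trapezoid : ℕ → ℚ
trapezoid q = ½ * (ε q + ε (suc q))

-- The bound of `h-upper` depends only on the ratio c/d, so the scale `M` cancels.
h-trapezoid : ∀ M q → h (M ℕ.* (2 ℕ.+ q)) ≤ h (M ℕ.* suc q) + trapezoid q
h-trapezoid zero q = p≤p+q 0ℚ (0≤* 0≤½ (0≤+ (0≤ε q) (0≤ε (suc q))))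
h-trapezoid M@(suc M-1) q = subst (λ z → h (M ℕ.* (2 ℕ.+ q)) ≤ h (M ℕ.* suc q) + ½ * z) (begin
    fromℕ (M ℕ.* (2 ℕ.+ q)) * (μ * ε q) - fromℕ (M ℕ.* suc q) * (μ * ε (suc q))
      ≡⟨ cong₂ (λ x y → x * (μ * ε q) - y * (μ * ε (suc q)))
           (trans (fromℕ-* M (2 ℕ.+ q)) (cong (fromℕ M *_) (fromℕ-suc (suc q))))
           (trans (fromℕ-* M (suc q)) (cong (fromℕ M *_) (sym (cancel-suc {fromℕ (2 ℕ.+ q)} {fromℕ (suc q)} (fromℕ-suc (suc q)))))) ⟩
    fromℕ M * (1ℚ + fromℕ (suc q)) * (μ * ε q) - fromℕ M * (fromℕ (2 ℕ.+ q) - 1ℚ) * (μ * ε (suc q))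
      ≡⟨ solve 6 (λ m u x y a b → m :* (con 1ℚ :+ x) :* (u :* a) :- m :* (y :- con 1ℚ) :* (u :* b)
           := u :* m :* (a :+ a :* x :- b :* y :+ b)) refl
           (fromℕ M) μ (fromℕ (suc q)) (fromℕ (2 ℕ.+ q)) (ε q) (ε (suc q)) ⟩
    μ * fromℕ M * (ε q + ε q * fromℕ (suc q) - ε (suc q) * fromℕ (2 ℕ.+ q) + ε (suc q))
      ≡⟨ cong₂ (λ x y → x * (ε q + y - ε (suc q) * fromℕ (2 ℕ.+ q) + ε (suc q))) (ε*suc≡1 M-1) (ε*suc≡1 q) ⟩
    1ℚ * (ε q + 1ℚ - ε (suc q) * fromℕ (2 ℕ.+ q) + ε (suc q))
      ≡⟨ cong (λ x → 1ℚ * (ε q + 1ℚ - x + ε (suc q))) (ε*suc≡1 (suc q)) ⟩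
    1ℚ * (ε q + 1ℚ - 1ℚ + ε (suc q))
      ≡⟨ solve 2 (λ a b → con 1ℚ :* (a :+ con 1ℚ :- con 1ℚ :+ b) := a :+ b) refl (ε q) (ε (suc q)) ⟩
    ε q + ε (suc q) ∎)
  (h-upper {M ℕ.* (2 ℕ.+ q)} {M ℕ.* suc q} {μ * ε (suc q)} {μ * ε q} (inverse-* (suc q)) (inverse-* q) (ℕ.*-monoʳ-≤ M (ℕ.n≤1+n (suc q))))
  where
  open ≡-Reasoning
  μ = ε M-1
  cancel-suc : ∀ {x y} → x ≡ 1ℚ + y → x - 1ℚ ≡ y
  cancel-suc {y = y} refl = solve 1 (λ y → con 1ℚ :+ y :- con 1ℚ := y) refl y
  inverse-* : ∀ q → μ * ε q * fromℕ (M ℕ.* suc q) ≡ 1ℚ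
  inverse-* q = begin
    μ * ε q * fromℕ (M ℕ.* suc q)              ≡⟨ cong (μ * ε q *_) (fromℕ-* M (suc q)) ⟩
    μ * ε q * (fromℕ M * fromℕ (suc q))        ≡⟨ solve 4 (λ u e m s → u :* e :* (m :* s) := (u :* m) :* (e :* s)) refl μ (ε q) (fromℕ M) (fromℕ (suc q)) ⟩
    (μ * fromℕ M) * (ε q * fromℕ (suc q))      ≡⟨ cong₂ _*_ (ε*suc≡1 M-1) (ε*suc≡1 q) ⟩
    1ℚ                                         ∎

h-trapezoids : ∀ M q n → h (M ℕ.* (suc q ℕ.+ n)) ≤ h (M ℕ.* suc q) + ∑ n (λ i → trapezoid (q ℕ.+ i))
h-trapezoids M q zero rewrite ℕ.+-identityʳ q = p≤p+q (h (M ℕ.* suc q)) ≤-refl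
h-trapezoids M q (suc n) rewrite ℕ.+-suc q n = begin
  h (M ℕ.* (2 ℕ.+ (q ℕ.+ n)))
    ≤⟨ h-trapezoid M (q ℕ.+ n) ⟩
  h (M ℕ.* suc (q ℕ.+ n)) + trapezoid (q ℕ.+ n)
    ≤⟨ +-monoˡ-≤ _ (h-trapezoids M q n) ⟩
  h (M ℕ.* suc q) + ∑ n (λ i → trapezoid (q ℕ.+ i)) + trapezoid (q ℕ.+ n)
    ≡⟨ +-assoc (h (M ℕ.* suc q)) _ _ ⟩
  h (M ℕ.* suc q) + (∑ n (λ i → trapezoid (q ℕ.+ i)) + trapezoid (q ℕ.+ n)) ∎
  where open ≤-Reasoning

-- s - s² is a lower bound for log (c/2d), where c/d = η and s = η/2 - 1.
h-double : ∀ c d .{{_ : ℕ.NonZero c}} .{{_ : ℕ.NonZero d}} {η} → η * fromℕ d ≡ fromℕ c → 1ℚ ≤ η →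
  let s = (η - + 2 / 1) * ½ in h (d ℕ.+ d) + (s - s * s) ≤ h c
h-double c@(suc c-1) d@(suc d-1) {η} ηd≡c 1≤η = helper (ℕ.≤-total (d ℕ.+ d) c)
  where
  open ≤-Reasoning
  s = (η - + 2 / 1) * ½
  K = (fromℕ d + fromℕ d) * ε c-1
  0≤K : 0ℚ ≤ K
  0≤K = 0≤* (0≤+ (0≤fromℕ d) (0≤fromℕ d)) (0≤ε c-1)
  [1+s]K≡1 : (1ℚ + s) * K ≡ 1ℚ
  [1+s]K≡1 = trans
    (solve 3 (λ η d e → (con 1ℚ :+ (η :- con (+ 2 / 1)) :* con ½) :* ((d :+ d) :* e) := e :* (η :* d)) refl η (fromℕ d) (ε c-1))
    (trans (cong (ε c-1 *_) ηd≡c) (ε*suc≡1 c-1))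
  fromℕ[2d] : fromℕ (d ℕ.+ d) ≡ fromℕ d + fromℕ d
  fromℕ[2d] = fromℕ-+ d d
  0≤s : d ℕ.+ d ℕ.≤ c → 0ℚ ≤ s
  0≤s 2d≤c = *-cancelʳ-≤-pos (fromℕ d + fromℕ d) {{subst Positive fromℕ[2d] (fromℕ-pos (d ℕ.+ d))}} (begin
    0ℚ * (fromℕ d + fromℕ d)        ≡⟨ *-zeroˡ (fromℕ d + fromℕ d) ⟩
    0ℚ                              ≤⟨ p≤q⇒0≤q-p (fromℕ-mono 2d≤c) ⟩
    fromℕ c - fromℕ (d ℕ.+ d)       ≡⟨ cong₂ _-_ (sym ηd≡c) fromℕ[2d] ⟩
    η * fromℕ d - (fromℕ d + fromℕ d) ≡⟨ solve 2 (λ η d → η :* d :- (d :+ d) := (η :- con (+ 2 / 1)) :* con ½ :* (d :+ d)) refl η (fromℕ d) ⟩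
    s * (fromℕ d + fromℕ d)         ∎)
  helper : _ → h (d ℕ.+ d) + (s - s * s) ≤ h c
  -- For s ≥ 0, `h-lower` yields 1 - K with K = 1/(1 + s), and this exceeds s - s² by K s³.
  helper (inj₁ 2d≤c) = begin
    h (d ℕ.+ d) + (s - s * s)
      ≤⟨ p≤p+q _ (0≤* 0≤K (0≤* (0≤s 2d≤c) (0≤p*p s))) ⟩
    h (d ℕ.+ d) + (s - s * s) + K * (s * (s * s))
      ≡⟨ solve 3 (λ h s K → h :+ (s :- s :* s) :+ K :* (s :* (s :* s))
           := h :+ (s :- s :* s :- ((con 1ℚ :+ s) :* K) :* (s :- s :* s :- con 1ℚ)) :- K) refl (h (d ℕ.+ d)) s K ⟩
    h (d ℕ.+ d) + (s - s * s - ((1ℚ + s) * K) * (s - s * s - 1ℚ)) - K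
      ≡⟨ cong (λ z → h (d ℕ.+ d) + (s - s * s - z * (s - s * s - 1ℚ)) - K) [1+s]K≡1 ⟩
    h (d ℕ.+ d) + (s - s * s - 1ℚ * (s - s * s - 1ℚ)) - K
      ≡⟨ solve 3 (λ h s K → h :+ (s :- s :* s :- con 1ℚ :* (s :- s :* s :- con 1ℚ)) :- K := h :+ (con 1ℚ :- K)) refl (h (d ℕ.+ d)) s K ⟩
    h (d ℕ.+ d) + (1ℚ - K)
      ≡⟨ cong (λ z → h (d ℕ.+ d) + (1ℚ - z * ε c-1)) fromℕ[2d] ⟨
    h (d ℕ.+ d) + (1ℚ - fromℕ (d ℕ.+ d) * ε c-1)
      ≤⟨ h-lower {C = ε c-1} (ε*suc≡1 c-1) 2d≤c ⟩
    h c ∎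
  -- For s ≤ 0, `h-upper` bounds h (2d) - h c by ½ (K - (1 + s)). Adding s - s² gives -½ K s² (η -
  -- 1), which is at most 0 because 1 ≤ η.
  helper (inj₂ c≤2d) = begin
    h (d ℕ.+ d) + (s - s * s)
      ≤⟨ +-monoˡ-≤ (s - s * s) (h-upper {C = E} {D = ε c-1} (ε*suc≡1 (d-1 ℕ.+ d)) (ε*suc≡1 c-1) c≤2d) ⟩
    h c + ½ * (fromℕ (d ℕ.+ d) * ε c-1 - fromℕ c * E) + (s - s * s)
      ≡⟨ cong₂ (λ x y → h c + ½ * (x * ε c-1 - y) + (s - s * s)) fromℕ[2d] cE≡1+s ⟩
    h c + ½ * (K - (1ℚ + s)) + (s - s * s)
      ≤⟨ p≤p+q _ (0≤* (0≤* (0≤* 0≤½ 0≤K) (0≤p*p s)) (p≤q⇒0≤q-p 1≤η)) ⟩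
    h c + ½ * (K - (1ℚ + s)) + (s - s * s) + ½ * K * (s * s) * (η - 1ℚ)
      ≡⟨ solve 3 (λ h η K → let s = (η :- con (+ 2 / 1)) :* con ½ in
           h :+ con ½ :* (K :- (con 1ℚ :+ s)) :+ (s :- s :* s) :+ con ½ :* K :* (s :* s) :* (η :- con 1ℚ)
           := h :+ con ½ :* (((con 1ℚ :+ s) :* K) :* (con 1ℚ :- s :+ (s :* s :+ s :* s)) :- (con 1ℚ :- s :+ (s :* s :+ s :* s)))) refl (h c) η K ⟩
    h c + ½ * (((1ℚ + s) * K) * (1ℚ - s + (s * s + s * s)) - (1ℚ - s + (s * s + s * s)))
      ≡⟨ cong (λ z → h c + ½ * (z * (1ℚ - s + (s * s + s * s)) - (1ℚ - s + (s * s + s * s)))) [1+s]K≡1 ⟩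
    h c + ½ * (1ℚ * (1ℚ - s + (s * s + s * s)) - (1ℚ - s + (s * s + s * s)))
      ≡⟨ solve 2 (λ h z → h :+ con ½ :* (con 1ℚ :* z :- z) := h) refl (h c) (1ℚ - s + (s * s + s * s)) ⟩
    h c ∎
    where
    E = ε (d-1 ℕ.+ d)
    cE≡1+s : fromℕ c * E ≡ 1ℚ + s
    cE≡1+s = trans (cong (_* E) (sym ηd≡c)) (trans
      (solve 3 (λ η d e → η :* d :* e := (con 1ℚ :+ (η :- con (+ 2 / 1)) :* con ½) :* (e :* (d :+ d))) refl η (fromℕ d) E)
      (trans (cong (λ z → (1ℚ + s) * (E * z)) (sym fromℕ[2d]))
      (trans (cong ((1ℚ + s) *_) (ε*suc≡1 (d-1 ℕ.+ d))) (*-identityʳ (1ℚ + s)))))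

-- Riemann sums for log 2

-- At x = 2 the scaled partition point (N - j) + 2j is N + j, so the Riemann sum is exactly h (2N) -
-- h N.
term≡ε : ∀ N .{{_ : ℕ.NonZero N}} i → i ℕ.< N → term (+ 2 / 1) N (suc i) ≡ ε (N ℕ.+ i)
term≡ε N i i<N = inverse-unique (fromℕ (suc (N ℕ.+ i)))
  (trans (cong (term (+ 2 / 1) N (suc i) *_) (sym N*t≡)) (term-spec (+ 2 / 1) N (suc i)))
  (ε*suc≡1 (N ℕ.+ i))
  where
  open ≡-Reasoning
  d = N ℕ.∸ suc i
  N*t≡ : N*t (+ 2 / 1) N (suc i) ≡ fromℕ (suc (N ℕ.+ i))
  N*t≡ = begin
    fromℕ d + fromℕ (suc i) * (+ 2 / 1)
      ≡⟨ solve 2 (λ d s → d :+ s :* con (+ 2 / 1) := (s :+ d) :+ s) refl (fromℕ d) (fromℕ (suc i)) ⟩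
    fromℕ (suc i) + fromℕ d + fromℕ (suc i)
      ≡⟨ cong (_+ fromℕ (suc i)) (trans (sym (fromℕ-+ (suc i) d)) (cong fromℕ (ℕ.m+[n∸m]≡n i<N))) ⟩
    fromℕ N + fromℕ (suc i)
      ≡⟨ fromℕ-+ N (suc i) ⟨
    fromℕ (N ℕ.+ suc i)
      ≡⟨ cong fromℕ (ℕ.+-suc N i) ⟩
    fromℕ (suc (N ℕ.+ i)) ∎

riemannSum≤ : ∀ N .{{_ : ℕ.NonZero N}} → h N + riemannSum (+ 2 / 1) N ≤ h (N ℕ.+ N)
riemannSum≤ N = ≤-trans (+-monoʳ-≤ (h N) (∑-mono N λ i i<N → ≤-reflexive (term≡ε N i i<N)))
  (≤-reflexive (sym (∑-split N N ε)))

-- Refining a lower sum can only increase it. The free factor `M` lets the partition match whatever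
-- denominators are in play.
riemannSum-multiple≤ : ∀ N M .{{_ : ℕ.NonZero N}} .{{_ : ℕ.NonZero M}} →
  h (N ℕ.* M) + riemannSum (+ 2 / 1) N ≤ h (N ℕ.* M ℕ.+ N ℕ.* M)
riemannSum-multiple≤ N M = ≤-trans
  (+-monoʳ-≤ (h (N ℕ.* M)) (riemannSum-refine-lower (+ 2 / 1) N M))
  (riemannSum≤ (N ℕ.* M))
  where
  instance
    NM≢0 : ℕ.NonZero (N ℕ.* M)
    NM≢0 = ℕ.m*n≢0 N M

-- Increments of `h` over one prime and over a product of primes

-- An upper bound for log (p/(p-1)) - 1/p.  For p ≥ 4 it comes from the trapezoid rule on [p-1, p],
-- which is not sharp enough for p = 3; there [2, 3] is cut into six parts, whence the factor 6 in
-- the scales below.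
excess : ℕ → ℚ
excess (suc (suc (suc zero)))       = + 7 / 96
excess (suc (suc (suc (suc q))))    = ½ * (ε (2 ℕ.+ q) - ε (3 ℕ.+ q))
excess _                            = 0ℚ

0≤excess : ∀ p → 0ℚ ≤ excess p
0≤excess 0 = ≤-refl
0≤excess 1 = ≤-refl
0≤excess 2 = ≤-refl
0≤excess 3 = nonNegative⁻¹ (+ 7 / 96)
0≤excess (suc (suc (suc (suc q)))) = 0≤* 0≤½ (p≤q⇒0≤q-p (ε-antitone (ℕ.n≤1+n (2 ℕ.+ q))))

h-prime : ∀ M {p} (pr : Prime p) → 3 ℕ.≤ p →
          h (M ℕ.* 6 ℕ.* p) ≤ h (M ℕ.* 6 ℕ.* ℕ.pred p) + (1/prime pr + excess p)
h-prime M {suc (suc (suc zero))} pr _ = begin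
  h (M ℕ.* 6 ℕ.* 3)      ≡⟨ cong h (ℕ.*-assoc M 6 3) ⟩
  h (M ℕ.* 18)           ≤⟨ h-trapezoids M 11 6 ⟩
  h (M ℕ.* 12) + ∑ 6 (λ i → trapezoid (11 ℕ.+ i))
                         -- The six trapezoids add up to about 0.4058, and 1/3 + 7/96 = 13/32 =
                         -- 0.40625.
                         ≤⟨ +-monoʳ-≤ (h (M ℕ.* 12)) (from-yes (∑ 6 (λ i → trapezoid (11 ℕ.+ i)) ≤? + 1 / 3 + + 7 / 96)) ⟩
  h (M ℕ.* 12) + (+ 1 / 3 + + 7 / 96)
                         ≡⟨ cong (λ m → h m + (+ 1 / 3 + + 7 / 96)) (ℕ.*-assoc M 6 2) ⟨
  h (M ℕ.* 6 ℕ.* 2) + (+ 1 / 3 + + 7 / 96) ∎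
  where open ≤-Reasoning
-- With p = q + 4, the trapezoid ½ (1/(p-1) + 1/p) is 1/p + 1/(2p(p-1)).
h-prime M {suc (suc (suc (suc q)))} pr _ = subst (λ z → h (M ℕ.* 6 ℕ.* (4 ℕ.+ q)) ≤ h (M ℕ.* 6 ℕ.* (3 ℕ.+ q)) + z)
  (solve 2 (λ a b → con ½ :* (a :+ b) := b :+ con ½ :* (a :- b)) refl (ε (2 ℕ.+ q)) (ε (3 ℕ.+ q)))
  (h-trapezoid (M ℕ.* 6) (2 ℕ.+ q))
h-prime M {suc (suc zero)} pr (ℕ.s≤s (ℕ.s≤s ()))
h-prime M {suc zero} pr (ℕ.s≤s ())

-- The sum `T` and the product `H` over an arbitrary list of prime divisors, to allow induction. At
-- `primeDivisors-correct n` they are `T n` and `H n` by definition.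
∑1/p : ∀ {n xs} → All (PrimeDivisorOf n) xs → ℚ
∑1/p pxs = foldr _+_ 0ℚ (All.reduce (λ pd → 1/prime (proj₁ pd)) pxs)

∏p/[p-1] : ∀ {n xs} → All (PrimeDivisorOf n) xs → ℚ
∏p/[p-1] pxs = foldr _*_ 1ℚ (All.reduce (λ pd → p/[p-1] (proj₁ pd)) pxs)

∑excess : List ℕ → ℚ
∑excess []       = 0ℚ
∑excess (x ∷ xs) = excess x + ∑excess xs

-- In the induction the scale M absorbs the cofactors of p and p-1.
h-product : ∀ M {n xs} (pxs : All (PrimeDivisorOf n) xs) → All (3 ℕ.≤_) xs →
  h (M ℕ.* 6 ℕ.* product xs) ≤ h (M ℕ.* 6 ℕ.* product (map ℕ.pred xs)) + (∑1/p pxs + ∑excess xs)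
h-product M [] [] = p≤p+q _ (nonNegative⁻¹ 0ℚ)
h-product M {xs = p ∷ xs} ((pr , _) ∷ pxs) (3≤p ∷ 3≤xs) = begin
  h (M ℕ.* 6 ℕ.* (p ℕ.* a))
    ≡⟨ cong h (ℕS.solve 3 (λ m p a → m ℕS.:* ℕS.con 6 ℕS.:* (p ℕS.:* a) ℕS.:= m ℕS.:* p ℕS.:* ℕS.con 6 ℕS.:* a) refl M p a) ⟩
  h (M ℕ.* p ℕ.* 6 ℕ.* a)
    ≤⟨ h-product (M ℕ.* p) pxs 3≤xs ⟩
  h (M ℕ.* p ℕ.* 6 ℕ.* b) + (∑1/p pxs + ∑excess xs)
    ≡⟨ cong (λ m → h m + (∑1/p pxs + ∑excess xs))
         (ℕS.solve 3 (λ m p b → m ℕS.:* p ℕS.:* ℕS.con 6 ℕS.:* b ℕS.:= m ℕS.:* b ℕS.:* ℕS.con 6 ℕS.:* p) refl M p b) ⟩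
  h (M ℕ.* b ℕ.* 6 ℕ.* p) + (∑1/p pxs + ∑excess xs)
    ≤⟨ +-monoˡ-≤ (∑1/p pxs + ∑excess xs) (h-prime (M ℕ.* b) pr 3≤p) ⟩
  h (M ℕ.* b ℕ.* 6 ℕ.* ℕ.pred p) + (1/prime pr + excess p) + (∑1/p pxs + ∑excess xs)
    ≡⟨ solve 5 (λ h a b c d → h :+ (a :+ b) :+ (c :+ d) := h :+ ((a :+ c) :+ (b :+ d))) refl
         (h (M ℕ.* b ℕ.* 6 ℕ.* ℕ.pred p)) (1/prime pr) (excess p) (∑1/p pxs) (∑excess xs) ⟩
  h (M ℕ.* b ℕ.* 6 ℕ.* ℕ.pred p) + ((1/prime pr + ∑1/p pxs) + (excess p + ∑excess xs))
    ≡⟨ cong (λ m → h m + ((1/prime pr + ∑1/p pxs) + (excess p + ∑excess xs)))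
         (ℕS.solve 3 (λ m p b → m ℕS.:* b ℕS.:* ℕS.con 6 ℕS.:* p ℕS.:= m ℕS.:* ℕS.con 6 ℕS.:* (p ℕS.:* b)) refl M (ℕ.pred p) b) ⟩
  h (M ℕ.* 6 ℕ.* (ℕ.pred p ℕ.* b)) + ((1/prime pr + ∑1/p pxs) + (excess p + ∑excess xs)) ∎
  where
  open ≤-Reasoning
  module ℕS = ℕ-Solver
  a = product xs
  b = product (map ℕ.pred xs)

-- The product of p/(p-1) over a list of primes

p/[p-1]-spec : ∀ {p} (pr : Prime p) → p/[p-1] pr * fromℕ (ℕ.pred p) ≡ fromℕ p
p/[p-1]-spec {zero}        pr = ⊥-elim (¬prime[0] pr)
p/[p-1]-spec {suc zero}    pr = ⊥-elim (¬prime[1] pr)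
p/[p-1]-spec {suc (suc q)} pr = begin
  + (2 ℕ.+ q) / suc q * fromℕ (suc q)      ≡⟨ cong (_* fromℕ (suc q)) (/≡*ε (2 ℕ.+ q) q) ⟩
  fromℕ (2 ℕ.+ q) * ε q * fromℕ (suc q)    ≡⟨ *-assoc (fromℕ (2 ℕ.+ q)) (ε q) (fromℕ (suc q)) ⟩
  fromℕ (2 ℕ.+ q) * (ε q * fromℕ (suc q))  ≡⟨ cong (fromℕ (2 ℕ.+ q) *_) (ε*suc≡1 q) ⟩
  fromℕ (2 ℕ.+ q) * 1ℚ                     ≡⟨ *-identityʳ (fromℕ (2 ℕ.+ q)) ⟩
  fromℕ (2 ℕ.+ q)                          ∎
  where open ≡-Reasoning

∏p/[p-1]-spec : ∀ {n xs} (pxs : All (PrimeDivisorOf n) xs) →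
  ∏p/[p-1] pxs * fromℕ (product (map ℕ.pred xs)) ≡ fromℕ (product xs)
∏p/[p-1]-spec [] = refl
∏p/[p-1]-spec {xs = p ∷ xs} ((pr , _) ∷ pxs) = begin
  x * y * fromℕ (ℕ.pred p ℕ.* b)            ≡⟨ cong (x * y *_) (fromℕ-* (ℕ.pred p) b) ⟩
  x * y * (fromℕ (ℕ.pred p) * fromℕ b)      ≡⟨ solve 4 (λ x y p b → x :* y :* (p :* b) := x :* p :* (y :* b)) refl x y (fromℕ (ℕ.pred p)) (fromℕ b) ⟩
  x * fromℕ (ℕ.pred p) * (y * fromℕ b)      ≡⟨ cong₂ _*_ (p/[p-1]-spec pr) (∏p/[p-1]-spec pxs) ⟩
  fromℕ p * fromℕ (product xs)              ≡⟨ fromℕ-* p (product xs) ⟨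
  fromℕ (p ℕ.* product xs)                  ∎
  where
  open ≡-Reasoning
  x = p/[p-1] pr
  y = ∏p/[p-1] pxs
  b = product (map ℕ.pred xs)

p/[p-1]*1/p : ∀ {p} (pr : Prime p) → p/[p-1] pr * 1/prime pr ≡ p/[p-1] pr - 1ℚ
p/[p-1]*1/p {zero}        pr = ⊥-elim (¬prime[0] pr)
p/[p-1]*1/p {suc zero}    pr = ⊥-elim (¬prime[1] pr)
p/[p-1]*1/p {suc (suc q)} pr = begin
  x * ε (suc q)                             ≡⟨ cong (_* ε (suc q)) (/≡*ε (2 ℕ.+ q) q) ⟩
  fromℕ (2 ℕ.+ q) * ε q * ε (suc q)         ≡⟨ solve 3 (λ p a b → p :* a :* b := a :* (b :* p)) refl (fromℕ (2 ℕ.+ q)) (ε q) (ε (suc q)) ⟩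
  ε q * (ε (suc q) * fromℕ (2 ℕ.+ q))       ≡⟨ cong (ε q *_) (ε*suc≡1 (suc q)) ⟩
  ε q * 1ℚ                                  ≡⟨ solve 1 (λ a → a :* con 1ℚ := (a :+ con 1ℚ) :- con 1ℚ) refl (ε q) ⟩
  (ε q + 1ℚ) - 1ℚ                           ≡⟨ cong (λ z → (ε q + z) - 1ℚ) (ε*suc≡1 q) ⟨
  (ε q + ε q * fromℕ (suc q)) - 1ℚ          ≡⟨ cong (_- 1ℚ) (solve 2 (λ a s → a :+ a :* s := (con 1ℚ :+ s) :* a) refl (ε q) (fromℕ (suc q))) ⟩
  (1ℚ + fromℕ (suc q)) * ε q - 1ℚ           ≡⟨ cong (λ z → z * ε q - 1ℚ) (fromℕ-suc (suc q)) ⟨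
  fromℕ (2 ℕ.+ q) * ε q - 1ℚ                ≡⟨ cong (_- 1ℚ) (/≡*ε (2 ℕ.+ q) q) ⟨
  x - 1ℚ                                    ∎
  where
  open ≡-Reasoning
  x = + (2 ℕ.+ q) / suc q

0≤p/[p-1] : ∀ {p} (pr : Prime p) → 0ℚ ≤ p/[p-1] pr
0≤p/[p-1] {zero}        pr = ⊥-elim (¬prime[0] pr)
0≤p/[p-1] {suc zero}    pr = ⊥-elim (¬prime[1] pr)
0≤p/[p-1] {suc (suc q)} pr = nonNegative⁻¹ (+ (2 ℕ.+ q) / suc q) {{normalize-nonNeg (2 ℕ.+ q) (suc q)}}

1≤p/[p-1] : ∀ {p} (pr : Prime p) → 1ℚ ≤ p/[p-1] pr
1≤p/[p-1] {zero}        pr = ⊥-elim (¬prime[0] pr)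
1≤p/[p-1] {suc zero}    pr = ⊥-elim (¬prime[1] pr)
1≤p/[p-1] {suc (suc q)} pr = ≤-by (x * ε (suc q)) (0≤* (0≤p/[p-1] pr) (0≤ε (suc q)))
  (trans (solve 1 (λ x → x := con 1ℚ :+ (x :- con 1ℚ)) refl x) (cong (_+_ 1ℚ) (sym (p/[p-1]*1/p pr))))
  where x = p/[p-1] pr

1≤∏p/[p-1] : ∀ {n xs} (pxs : All (PrimeDivisorOf n) xs) → 1ℚ ≤ ∏p/[p-1] pxs
1≤∏p/[p-1] [] = ≤-refl
1≤∏p/[p-1] ((pr , _) ∷ pxs) = ≤-by (x * (y - 1ℚ) + (x - 1ℚ))
  (0≤+ (0≤* (0≤p/[p-1] pr) (p≤q⇒0≤q-p (1≤∏p/[p-1] pxs))) (p≤q⇒0≤q-p (1≤p/[p-1] pr)))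
  (solve 2 (λ x y → x :* y := con 1ℚ :+ (x :* (y :- con 1ℚ) :+ (x :- con 1ℚ))) refl x y)
  where
  x = p/[p-1] pr
  y = ∏p/[p-1] pxs

-- 1 - ∏ (1 - 1/p) ≤ ∑ 1/p, multiplied by ∏ p/(p-1).
∏-1≤∏*∑ : ∀ {n xs} (pxs : All (PrimeDivisorOf n) xs) → ∏p/[p-1] pxs - 1ℚ ≤ ∏p/[p-1] pxs * ∑1/p pxs
∏-1≤∏*∑ [] = ≤-refl
∏-1≤∏*∑ ((pr , _) ∷ pxs) = begin
  x * y - 1ℚ
    ≤⟨ p≤p+q (x * y - 1ℚ) (0≤+ (0≤* (p≤q⇒0≤q-p (1≤p/[p-1] pr)) (p≤q⇒0≤q-p (1≤∏p/[p-1] pxs)))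
         (0≤* (0≤p/[p-1] pr) (p≤q⇒0≤q-p (∏-1≤∏*∑ pxs)))) ⟩
  x * y - 1ℚ + ((x - 1ℚ) * (y - 1ℚ) + x * (y * T′ - (y - 1ℚ)))
    ≡⟨ solve 3 (λ x y t → x :* y :- con 1ℚ :+ ((x :- con 1ℚ) :* (y :- con 1ℚ) :+ x :* (y :* t :- (y :- con 1ℚ)))
         := (x :- con 1ℚ) :* y :+ x :* (y :* t)) refl x y T′ ⟩
  (x - 1ℚ) * y + x * (y * T′)
    ≡⟨ cong (λ z → z * y + x * (y * T′)) (p/[p-1]*1/p pr) ⟨
  x * t * y + x * (y * T′)
    ≡⟨ solve 4 (λ x y t T → x :* t :* y :+ x :* (y :* T) := x :* y :* (t :+ T)) refl x y t T′ ⟩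
  x * y * (t + T′) ∎
  where
  open ≤-Reasoning
  x = p/[p-1] pr
  y = ∏p/[p-1] pxs
  t = 1/prime pr
  T′ = ∑1/p pxs

-- The sum of the excesses over odd primes

2∣n⊎2∣1+n : ∀ n → 2 ∣ n ⊎ 2 ∣ suc n
2∣n⊎2∣1+n zero = inj₁ (divides 0 refl)
2∣n⊎2∣1+n (suc n) with 2∣n⊎2∣1+n n
... | inj₁ 2∣n = inj₂ (∣m∣n⇒∣m+n (∣-refl {2}) 2∣n)
... | inj₂ 2∣1+n = inj₁ 2∣1+n

2∣prime⇒≡2 : ∀ {p} → Prime p → 2 ∣ p → 2 ≡ p
2∣prime⇒≡2 pr 2∣p with prime⇒irreducible pr 2∣p
... | inj₂ 2≡p = 2≡p

-- If q were p + 1, one of the two would be even, hence equal to 2, yet both are at least 3. The gap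
-- of 2 is what `tail-step` steps over.
prime-gap : ∀ {p q} → Prime p → Prime q → 3 ℕ.≤ p → p ℕ.< q → 2 ℕ.+ p ℕ.≤ q
prime-gap {p} {q} pr qr 3≤p p<q with ℕ.m≤n⇒m<n∨m≡n p<q
... | inj₁ 1+p<q = 1+p<q
... | inj₂ refl with 2∣n⊎2∣1+n p
...   | inj₁ 2∣p   = ⊥-elim (ℕ.<⇒≢ 3≤p (2∣prime⇒≡2 pr 2∣p))
...   | inj₂ 2∣1+p = ⊥-elim (ℕ.<⇒≢ (ℕ.m≤n⇒m≤1+n 3≤p) (2∣prime⇒≡2 qr 2∣1+p))

-- 1/(4m-6) for m = 4+k: a telescoping majorant of ∑ 1/(2x(x-1)) over the odd x ≥ m.
tail : ℕ → ℚ
tail k = ½ * ε (k ℕ.+ (k ℕ.+ 4))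

0≤tail : ∀ k → 0ℚ ≤ tail k
0≤tail k = 0≤* 0≤½ (0≤ε (k ℕ.+ (k ℕ.+ 4)))

tail-antitone : ∀ {j k} → j ℕ.≤ k → tail k ≤ tail j
tail-antitone j≤k = *-monoˡ-≤-nonNeg ½ (ε-antitone (ℕ.+-mono-≤ j≤k (ℕ.+-monoˡ-≤ 4 j≤k)))

fromℕ-affine : ∀ j c → fromℕ (j ℕ.+ (j ℕ.+ c)) ≡ fromℕ j + (fromℕ j + fromℕ c)
fromℕ-affine j c = trans (fromℕ-+ j (j ℕ.+ c)) (cong (_+_ (fromℕ j)) (fromℕ-+ j c))

-- With m = 4 + j, the drop 1/(4m-6) - 1/(4m+2) is 2/((2m-3)(2m+1)), and (2m-3)(2m+1) = 4m(m-1) - 3.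
-- So the drop is at least 1/(2m(m-1)), and the 3 reappears in the slack.
tail-step : ∀ j → excess (4 ℕ.+ j) + tail (2 ℕ.+ j) ≤ tail j
tail-step j = ≤-by (½ * (+ 3 / 1 * (A * B * (U * V)))) (0≤* 0≤½ (0≤* (nonNegative⁻¹ (+ 3 / 1))
    (0≤* (0≤* (0≤ε (2 ℕ.+ j)) (0≤ε (3 ℕ.+ j))) (0≤* (0≤ε (j ℕ.+ (j ℕ.+ 4))) (0≤ε (2 ℕ.+ j ℕ.+ (2 ℕ.+ j ℕ.+ 4)))))))
  (trans (solve 4 (λ A B U V → con ½ :* U := con ½ :* (A :- B) :+ con ½ :* V :+ con ½ :* ((U :- V) :- (A :- B))) refl A B U V)
    (cong (λ z → ½ * (A - B) + ½ * V + ½ * z) U-V-[A-B]≡))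
  where
  open ≡-Reasoning
  A = ε (2 ℕ.+ j)
  B = ε (3 ℕ.+ j)
  U = ε (j ℕ.+ (j ℕ.+ 4))
  V = ε (2 ℕ.+ j ℕ.+ (2 ℕ.+ j ℕ.+ 4))
  y = fromℕ j
  α = + 2 / 1 + y
  β = + 3 / 1 + y
  μ = y + (y + + 4 / 1)
  ν = α + (α + + 4 / 1)
  α≡ : fromℕ (2 ℕ.+ j) ≡ α
  α≡ = fromℕ-+ 2 j
  β≡ : fromℕ (3 ℕ.+ j) ≡ β
  β≡ = fromℕ-+ 3 j
  μ≡ : fromℕ (j ℕ.+ (j ℕ.+ 4)) ≡ μ
  μ≡ = fromℕ-affine j 4
  ν≡ : fromℕ (2 ℕ.+ j ℕ.+ (2 ℕ.+ j ℕ.+ 4)) ≡ ν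
  ν≡ = trans (fromℕ-affine (2 ℕ.+ j) 4) (cong (λ z → z + (z + + 4 / 1)) α≡)
  inverse : ∀ n {z} → fromℕ n ≡ z → ε n * (1ℚ + z) ≡ 1ℚ
  inverse n refl = ε*[1+n]≡1 n
  difference : ∀ m n {w z} → fromℕ m ≡ w → fromℕ n ≡ z → ε m - ε n ≡ (z - w) * (ε m * ε n)
  difference m n refl refl = ε-difference m n
  U-V-[A-B]≡ : (U - V) - (A - B) ≡ + 3 / 1 * (A * B * (U * V))
  U-V-[A-B]≡ = begin
    (U - V) - (A - B)
      ≡⟨ cong₂ _-_ (difference (j ℕ.+ (j ℕ.+ 4)) (2 ℕ.+ j ℕ.+ (2 ℕ.+ j ℕ.+ 4)) μ≡ ν≡) (difference (2 ℕ.+ j) (3 ℕ.+ j) α≡ β≡) ⟩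
    (ν - μ) * (U * V) - (β - α) * (A * B)
      ≡⟨ solve 5 (λ y A B U V → let α = con (+ 2 / 1) :+ y; β = con (+ 3 / 1) :+ y; μ = y :+ (y :+ con (+ 4 / 1)); ν = α :+ (α :+ con (+ 4 / 1)) in
           (ν :- μ) :* (U :* V) :- (β :- α) :* (A :* B) := con (+ 4 / 1) :* (U :* V) :* con 1ℚ :* con 1ℚ :- (A :* B) :* con 1ℚ :* con 1ℚ) refl y A B U V ⟩
    + 4 / 1 * (U * V) * 1ℚ * 1ℚ - (A * B) * 1ℚ * 1ℚ
      ≡⟨ cong₂ (λ a b → + 4 / 1 * (U * V) * a * b - (A * B) * 1ℚ * 1ℚ) (inverse (2 ℕ.+ j) α≡) (inverse (3 ℕ.+ j) β≡) ⟨
    + 4 / 1 * (U * V) * (A * (1ℚ + α)) * (B * (1ℚ + β)) - (A * B) * 1ℚ * 1ℚ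
      ≡⟨ cong₂ (λ a b → + 4 / 1 * (U * V) * (A * (1ℚ + α)) * (B * (1ℚ + β)) - (A * B) * a * b)
           (inverse (j ℕ.+ (j ℕ.+ 4)) μ≡) (inverse (2 ℕ.+ j ℕ.+ (2 ℕ.+ j ℕ.+ 4)) ν≡) ⟨
    + 4 / 1 * (U * V) * (A * (1ℚ + α)) * (B * (1ℚ + β)) - (A * B) * (U * (1ℚ + μ)) * (V * (1ℚ + ν))
      ≡⟨ solve 5 (λ y A B U V → let α = con (+ 2 / 1) :+ y; β = con (+ 3 / 1) :+ y; μ = y :+ (y :+ con (+ 4 / 1)); ν = α :+ (α :+ con (+ 4 / 1)) in
           con (+ 4 / 1) :* (U :* V) :* (A :* (con 1ℚ :+ α)) :* (B :* (con 1ℚ :+ β)) :- (A :* B) :* (U :* (con 1ℚ :+ μ)) :* (V :* (con 1ℚ :+ ν))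
           := con (+ 3 / 1) :* (A :* B :* (U :* V))) refl y A B U V ⟩
    + 3 / 1 * (A * B * (U * V)) ∎

-- The elements after a head x are at least x + 2, so `tail-step` telescopes. Skipping ahead from 4
-- + k to x costs nothing, as `tail` is antitone.
∑excess≤tail : ∀ k {xs} → AllPairs ℕ._<_ xs → All Prime xs → All (4 ℕ.+ k ℕ.≤_) xs → ∑excess xs ≤ tail k
∑excess≤tail k [] [] [] = 0≤tail k
∑excess≤tail k {x ∷ xs} (x<xs ∷ xs↗) (pr ∷ prs) (4+k≤x ∷ _) with x ℕ.∸ (4 ℕ.+ k) | ℕ.m+[n∸m]≡n 4+k≤x
... | d | refl = begin
  excess (4 ℕ.+ j) + ∑excess xs          ≤⟨ +-monoʳ-≤ (excess (4 ℕ.+ j)) (∑excess≤tail (2 ℕ.+ j) xs↗ prs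
                                               (All.zipWith (λ (qr , x<q) → prime-gap pr qr 3≤x x<q) (prs , x<xs))) ⟩
  excess (4 ℕ.+ j) + tail (2 ℕ.+ j)      ≤⟨ tail-step j ⟩
  tail j                                 ≤⟨ tail-antitone (ℕ.m≤m+n k d) ⟩
  tail k                                 ∎
  where
  open ≤-Reasoning
  j = k ℕ.+ d
  3≤x : 3 ℕ.≤ 4 ℕ.+ j
  3≤x = ℕ.s≤s (ℕ.s≤s (ℕ.s≤s ℕ.z≤n))

-- Takes an arbitrary decision as argument, so that proofs can split on it abstractly while closed
-- instances still evaluate.
addIfTrue : ∀ {P : Set} → Dec P → ℚ → ℚ → ℚ
addIfTrue (yes _) v w = v + w
addIfTrue (no _)  v w = w

-- The excesses of the primes among 4+k, …, 3+k+f, and tail from there on.  When 3 ∣ n, bounding by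
-- tail alone would exceed 25/192.
primeTail : ℕ → ℕ → ℚ
primeTail zero    k = tail k
primeTail (suc f) k = addIfTrue (prime? (4 ℕ.+ k)) (excess (4 ℕ.+ k)) (primeTail f (suc k))

0≤primeTail : ∀ f k → 0ℚ ≤ primeTail f k
≤addIfTrue : ∀ {P : Set} (P? : Dec P) {v} w → 0ℚ ≤ v → w ≤ addIfTrue P? v w

≤addIfTrue (yes _) {v} w 0≤v = ≤-by v 0≤v (+-comm v w)
≤addIfTrue (no _)      w 0≤v = ≤-refl

0≤primeTail zero    k = 0≤tail k
0≤primeTail (suc f) k = ≤-trans (0≤primeTail f (suc k)) (≤addIfTrue (prime? (4 ℕ.+ k)) _ (0≤excess (4 ℕ.+ k)))

∑excess≤primeTail : ∀ f k {xs} → AllPairs ℕ._<_ xs → All Prime xs → All (4 ℕ.+ k ℕ.≤_) xs → ∑excess xs ≤ primeTail f k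
∑excess≤primeTail zero    k xs↗ prs ≤xs = ∑excess≤tail k xs↗ prs ≤xs
∑excess≤primeTail (suc f) k [] [] [] = 0≤primeTail (suc f) k
∑excess≤primeTail (suc f) k {x ∷ xs} (x<xs ∷ xs↗) (pr ∷ prs) (4+k≤x ∷ ≤xs) with ℕ.m≤n⇒m<n∨m≡n 4+k≤x
-- The list starts beyond 4 + k. If 4 + k is prime, its excess only weakens the bound.
... | inj₁ 4+k<x = ≤-trans
  (∑excess≤primeTail f (suc k) (x<xs ∷ xs↗) (pr ∷ prs) (4+k<x ∷ All.map (ℕ.<-trans 4+k<x) x<xs))
  (≤addIfTrue (prime? (4 ℕ.+ k)) _ (0≤excess (4 ℕ.+ k)))
... | inj₂ refl = take (prime? (4 ℕ.+ k))
  where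
  take : (P? : Dec (Prime (4 ℕ.+ k))) → excess (4 ℕ.+ k) + ∑excess xs ≤ addIfTrue P? (excess (4 ℕ.+ k)) (primeTail f (suc k))
  take (yes _)  = +-monoʳ-≤ (excess (4 ℕ.+ k)) (∑excess≤primeTail f (suc k) xs↗ prs x<xs)
  take (no ¬pr) = ⊥-elim (¬pr pr)

-- With p = 5 + j this reads 1/(4p-6) ≤ 25/(64p), that is 36p ≥ 150. It would fail at p = 3, which
-- is therefore treated numerically.
tail≤25/64 : ∀ j → tail (suc j) ≤ + 25 / 64 * ε (4 ℕ.+ j)
tail≤25/64 j = ≤-by (+ 1 / 64 * (A * B * (+ 18 / 1 * y + + 15 / 1)))
  (0≤* (nonNegative⁻¹ (+ 1 / 64)) (0≤* (0≤* (0≤ε (4 ℕ.+ j)) (0≤ε (suc j ℕ.+ (suc j ℕ.+ 4))))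
    (0≤+ (0≤* (nonNegative⁻¹ (+ 18 / 1)) (0≤fromℕ j)) (nonNegative⁻¹ (+ 15 / 1)))))
  (begin
    + 25 / 64 * A
      ≡⟨ solve 2 (λ A B → con (+ 25 / 64) :* A := con (+ 25 / 64) :* A :* con 1ℚ :+ con ½ :* (B :- B :* con 1ℚ)) refl A B ⟩
    + 25 / 64 * A * 1ℚ + ½ * (B - B * 1ℚ)
      ≡⟨ cong₂ (λ a b → + 25 / 64 * A * b + ½ * (B - B * a)) A≡ B≡ ⟨
    + 25 / 64 * A * (B * (1ℚ + (1ℚ + y + (1ℚ + y + + 4 / 1)))) + ½ * (B - B * (A * (1ℚ + (+ 4 / 1 + y))))
      ≡⟨ solve 3 (λ A B y → con (+ 25 / 64) :* A :* (B :* (con 1ℚ :+ (con 1ℚ :+ y :+ (con 1ℚ :+ y :+ con (+ 4 / 1))))) :+ con ½ :* (B :- B :* (A :* (con 1ℚ :+ (con (+ 4 / 1) :+ y))))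
           := con ½ :* B :+ con (+ 1 / 64) :* (A :* B :* (con (+ 18 / 1) :* y :+ con (+ 15 / 1)))) refl A B y ⟩
    ½ * B + + 1 / 64 * (A * B * (+ 18 / 1 * y + + 15 / 1)) ∎)
  where
  open ≡-Reasoning
  A = ε (4 ℕ.+ j)
  B = ε (suc j ℕ.+ (suc j ℕ.+ 4))
  y = fromℕ j
  A≡ : A * (1ℚ + (+ 4 / 1 + y)) ≡ 1ℚ
  A≡ = trans (cong (λ z → A * (1ℚ + z)) (sym (fromℕ-+ 4 j))) (ε*[1+n]≡1 (4 ℕ.+ j))
  B≡ : B * (1ℚ + (1ℚ + y + (1ℚ + y + + 4 / 1))) ≡ 1ℚ
  B≡ = trans (cong (λ z → B * (1ℚ + z)) (sym (trans (fromℕ-affine (suc j) 4) (cong (λ z → z + (z + + 4 / 1)) (fromℕ-suc j)))))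
    (ε*[1+n]≡1 (suc j ℕ.+ (suc j ℕ.+ 4)))

∑excess≤25/64 : ∀ {x xs} → AllPairs ℕ._<_ (suc x ∷ xs) → All Prime (suc x ∷ xs) → 3 ℕ.≤ suc x →
                ∑excess (suc x ∷ xs) ≤ + 25 / 64 * ε x
∑excess≤25/64 {zero} _ _ (ℕ.s≤s ())
∑excess≤25/64 {suc zero} _ _ (ℕ.s≤s (ℕ.s≤s ()))
∑excess≤25/64 {suc (suc zero)} (3<xs ∷ xs↗) (_ ∷ prs) _ = ≤-trans
  -- The excesses of the primes from 5 to 40 are added exactly, and `tail 37` = 1/158 covers the
  -- rest. With 7/96 the total is about 0.1297, against 25/192, about 0.1302.
  (+-monoʳ-≤ (+ 7 / 96) (∑excess≤primeTail 37 0 xs↗ prs 3<xs))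
  (from-yes (+ 7 / 96 + primeTail 37 0 ≤? + 25 / 64 * ε 2))
∑excess≤25/64 {suc (suc (suc zero))} _ (pr ∷ _) _ = ⊥-elim (from-no (prime? 4) pr)
∑excess≤25/64 {suc (suc (suc (suc j)))} (x<xs ∷ xs↗) prs _ = ≤-trans
  (∑excess≤tail (suc j) (x<xs ∷ xs↗) prs (ℕ.≤-refl ∷ All.map ℕ.<⇒≤ x<xs)) (tail≤25/64 j)

-- The list of prime divisors and the given factorization

primeDivisors-increasing : ∀ n → AllPairs ℕ._<_ (primeDivisors n)
primeDivisors-increasing n = AllPairs.filter⁺ (primeDivisorOf? n) (AllPairs.applyUpTo⁺₁ id (suc n) (λ i<j _ → i<j))

prime∣^⇒≡ : ∀ {p q} → Prime p → Prime q → ∀ m → q ∣ p ℕ.^ m → q ≡ p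
prime∣^⇒≡ pr qr zero    q∣1 = ⊥-elim (¬prime[1] (subst Prime (∣1⇒≡1 q∣1) qr))
prime∣^⇒≡ {p} pr qr (suc m) q∣p^1+m with euclidsLemma p (p ℕ.^ m) qr q∣p^1+m
... | inj₂ q∣p^m = prime∣^⇒≡ pr qr m q∣p^m
... | inj₁ q∣p with prime⇒irreducible pr q∣p
...   | inj₁ refl = ⊥-elim (¬prime[1] qr)
...   | inj₂ q≡p  = q≡p

prime∣∏⇒∣factor : ∀ {q k} (f : Vector ℕ k) → Prime q → q ∣ Vector.foldr ℕ._*_ 1 f → ∃ λ i → q ∣ f i
prime∣∏⇒∣factor {k = zero}  f qr q∣1 = ⊥-elim (¬prime[1] (subst Prime (∣1⇒≡1 q∣1) qr))
prime∣∏⇒∣factor {k = suc k} f qr q∣∏ with euclidsLemma (f zero) (Vector.foldr ℕ._*_ 1 (f ∘ suc)) qr q∣∏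
... | inj₁ q∣f₀ = zero , q∣f₀
... | inj₂ q∣∏′ with prime∣∏⇒∣factor (f ∘ suc) qr q∣∏′
...   | i , q∣fᵢ = suc i , q∣fᵢ

-- By Euclid's lemma a prime divisor of n divides some `p i ^ a i` and so equals `p i`. This ties p₁
-- to the list over which `T` and `H` are taken.
leastPrimeFactor≤ : ∀ {n k q} {p a : Vector ℕ (suc k)} → IsPrimeFactorization n p a → PrimeDivisorOf n q → p zero ℕ.≤ q
leastPrimeFactor≤ {p = p} {a} fac (qr , q∣n) with prime∣∏⇒∣factor _ qr (subst (_ ∣_) (IsPrimeFactorization.product fac) q∣n)
... | i , q∣pᵢ^aᵢ with prime∣^⇒≡ (IsPrimeFactorization.prime fac i) qr (a i) q∣pᵢ^aᵢ
...   | refl = p₀≤ i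
  where
  p₀≤ : ∀ i → p zero ℕ.≤ p i
  p₀≤ zero    = ℕ.≤-refl
  p₀≤ (suc i) = ℕ.<⇒≤ (IsPrimeFactorization.increasing fac (ℕ.s≤s ℕ.z≤n))

-- The bound for each Riemann sum, and its transfer to ℝ

+-cancelˡ-≤ : ∀ p {q r} → p + q ≤ p + r → q ≤ r
+-cancelˡ-≤ p {q} {r} p+q≤p+r = subst₂ _≤_ (cancel q) (cancel r) (+-monoʳ-≤ (- p) p+q≤p+r)
  where
  cancel : ∀ q → - p + (p + q) ≡ q
  cancel q = solve 2 (λ p q → :- p :+ (p :+ q) := q) refl p q

-- The constant is 1/2 + 25/128, the two terms available at the prime 2. The trapezoid rule with six
-- parts on [6, 12] gives about 0.6949, while 89/128 is about 0.6953.
riemannSum≤89/128 : ∀ N .{{_ : ℕ.NonZero N}} → riemannSum (+ 2 / 1) N ≤ + 89 / 128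
riemannSum≤89/128 N = +-cancelˡ-≤ (h (N ℕ.* 6)) (begin
  h (N ℕ.* 6) + riemannSum (+ 2 / 1) N   ≤⟨ riemannSum-multiple≤ N 6 ⟩
  h (N ℕ.* 6 ℕ.+ N ℕ.* 6)                ≡⟨ cong h (ℕ.*-distribˡ-+ N 6 6) ⟨
  h (N ℕ.* 12)                           ≤⟨ h-trapezoids N 5 6 ⟩
  h (N ℕ.* 6) + ∑ 6 (λ i → trapezoid (5 ℕ.+ i))
                                         ≤⟨ +-monoʳ-≤ (h (N ℕ.* 6)) (from-yes (∑ 6 (λ i → trapezoid (5 ℕ.+ i)) ≤? + 89 / 128)) ⟩
  h (N ℕ.* 6) + + 89 / 128               ∎)
  where open ≤-Reasoning

module _ {n xs} (pxs : All (PrimeDivisorOf n) xs) where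

  private
    y = ∏p/[p-1] pxs
    s = (y - + 2 / 1) * ½

  -- In the scale of `c` and `d`, the factor `N` makes the partition into N parts refinable, 6
  -- serves the prime 3 in `h-prime`, and `a` and `b` make c/d equal to `y`.
  riemannSum≤-odd : All (3 ℕ.≤_) xs → ∀ N .{{_ : ℕ.NonZero N}} →
    riemannSum (+ 2 / 1) N + (s - s * s) ≤ ∑1/p pxs + ∑excess xs
  riemannSum≤-odd 3≤xs N = +-cancelˡ-≤ (h d) (begin
    h d + (R + (s - s * s))                   ≡⟨ +-assoc (h d) R (s - s * s) ⟨
    h d + R + (s - s * s)                     ≤⟨ +-monoˡ-≤ (s - s * s) h+R≤ ⟩
    h (d ℕ.+ d) + (s - s * s)                 ≤⟨ h-double c d yd≡c (1≤∏p/[p-1] pxs) ⟩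
    h c                                       ≤⟨ h-product N pxs 3≤xs ⟩
    h d + (∑1/p pxs + ∑excess xs)             ∎)
    where
    open ≤-Reasoning
    R = riemannSum (+ 2 / 1) N
    a = product xs
    b = product (map ℕ.pred xs)
    c = N ℕ.* 6 ℕ.* a
    d = N ℕ.* 6 ℕ.* b
    instance
      a≢0 : ℕ.NonZero a
      a≢0 = product≢0 (All.map (λ 3≤x → ℕ.>-nonZero (ℕ.<-≤-trans (ℕ.s≤s ℕ.z≤n) 3≤x)) 3≤xs)
      b≢0 : ℕ.NonZero b
      b≢0 = product≢0 (All.map⁺ (All.map (λ 3≤x → ℕ.>-nonZero (ℕ.<-≤-trans (ℕ.s≤s ℕ.z≤n) (ℕ.pred-mono-≤ 3≤x))) 3≤xs))
      6b≢0 : ℕ.NonZero (6 ℕ.* b)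
      6b≢0 = ℕ.m*n≢0 6 b
      6N≢0 : ℕ.NonZero (N ℕ.* 6)
      6N≢0 = ℕ.m*n≢0 N 6
      c≢0 : ℕ.NonZero c
      c≢0 = ℕ.m*n≢0 (N ℕ.* 6) a
      d≢0 : ℕ.NonZero d
      d≢0 = ℕ.m*n≢0 (N ℕ.* 6) b
    h+R≤ : h d + R ≤ h (d ℕ.+ d)
    h+R≤ = subst (λ m → h m + R ≤ h (m ℕ.+ m)) (sym (ℕ.*-assoc N 6 b))
      (riemannSum-multiple≤ N (6 ℕ.* b))
    yd≡c : y * fromℕ d ≡ fromℕ c
    yd≡c = trans (cong (y *_) (fromℕ-* (N ℕ.* 6) b)) (trans
      (solve 3 (λ y m b → y :* (m :* b) := m :* (y :* b)) refl y (fromℕ (N ℕ.* 6)) (fromℕ b))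
      (trans (cong (fromℕ (N ℕ.* 6) *_) (∏p/[p-1]-spec pxs)) (sym (fromℕ-* (N ℕ.* 6) a))))

  -- Since y = 1 + t, `∏-1≤∏*∑` says t/(1 + t) ≤ ∑ 1/p, and (t - t²)(1 + t) = t - t³ ≤ t.
  ∑1/p≥ : let t = y - 1ℚ in t - t * t ≤ ∑1/p pxs
  ∑1/p≥ = *-cancelʳ-≤-pos y {{positive (<-≤-trans (positive⁻¹ 1ℚ) 1≤y)}} (begin
    (t - t * t) * y                ≤⟨ p≤p+q ((t - t * t) * y) (0≤* 0≤t (0≤* 0≤t 0≤t)) ⟩
    (t - t * t) * y + t * (t * t)  ≡⟨ solve 1 (λ y → let t = y :- con 1ℚ in (t :- t :* t) :* y :+ t :* (t :* t) := t) refl y ⟩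
    t                              ≤⟨ ∏-1≤∏*∑ pxs ⟩
    y * ∑1/p pxs                   ≡⟨ *-comm y (∑1/p pxs) ⟩
    ∑1/p pxs * y                   ∎)
    where
    open ≤-Reasoning
    t = y - 1ℚ
    1≤y = 1≤∏p/[p-1] pxs
    0≤t = p≤q⇒0≤q-p 1≤y

riemannSum≤-even : ∀ {n xs} (pd : PrimeDivisorOf n 2) (pxs : All (PrimeDivisorOf n) xs) →
  ∀ N .{{_ : ℕ.NonZero N}} → let s = (∏p/[p-1] (pd ∷ pxs) - + 2 / 1) * ½ in
  riemannSum (+ 2 / 1) N + (s - s * s) ≤ ∑1/p (pd ∷ pxs) + + 25 / 64 * ½
riemannSum≤-even pd pxs N = begin
  riemannSum (+ 2 / 1) N + (s - s * s)
    ≤⟨ +-monoˡ-≤ (s - s * s) (riemannSum≤89/128 N) ⟩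
  + 89 / 128 + (s - s * s)
    -- The prime 2 contributes the factor 2 to the product, so s is y - 1 and `∑1/p≥` applies to the
    -- remaining primes.
    ≡⟨ solve 1 (λ y → let s = (con (+ 2 / 1) :* y :- con (+ 2 / 1)) :* con ½; t = y :- con 1ℚ in
         con (+ 89 / 128) :+ (s :- s :* s) := con (+ 89 / 128) :+ (t :- t :* t)) refl y ⟩
  + 89 / 128 + ((y - 1ℚ) - (y - 1ℚ) * (y - 1ℚ))
    ≤⟨ +-monoʳ-≤ (+ 89 / 128) (∑1/p≥ pxs) ⟩
  + 89 / 128 + ∑1/p pxs
    ≡⟨ solve 1 (λ T → con (+ 89 / 128) :+ T := con ½ :+ T :+ con (+ 25 / 64) :* con ½) refl (∑1/p pxs) ⟩
  ½ + ∑1/p pxs + + 25 / 64 * ½ ∎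
  where
  open ≤-Reasoning
  y = ∏p/[p-1] pxs
  s = (+ 2 / 1 * y - + 2 / 1) * ½

1/prime-antitone : ∀ {p q} (pr : Prime p) → p ℕ.≤ suc q → ε q ≤ 1/prime pr
1/prime-antitone {zero}  pr _           = ⊥-elim (¬prime[0] pr)
1/prime-antitone {suc p} {q} pr (ℕ.s≤s p≤q) = ε-antitone {p} {q} p≤q

-- Splits on the least element of the list: 2 leads to the even bound, anything larger to the odd
-- one. Lowering `p` increases 1/p, so it suffices that `p` bounds the list from below.
riemannSum≤∑1/p : ∀ {n xs p} (pxs : All (PrimeDivisorOf n) xs) → AllPairs ℕ._<_ xs →
  (pr : Prime p) → All (p ℕ.≤_) xs → ∀ N .{{_ : ℕ.NonZero N}} → let s = (∏p/[p-1] pxs - + 2 / 1) * ½ in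
  riemannSum (+ 2 / 1) N + (s - s * s) ≤ ∑1/p pxs + + 25 / 64 * 1/prime pr
-- For the empty list the odd bound has right-hand side 0, and 25/(64p) is nonnegative.
riemannSum≤∑1/p {n} {p = p} [] [] pr [] N = ≤-trans (riemannSum≤-odd {n} [] [] N)
  (+-monoʳ-≤ 0ℚ (0≤* (nonNegative⁻¹ (+ 25 / 64)) (≤-trans (0≤ε p) (1/prime-antitone {q = p} pr (ℕ.n≤1+n p)))))
riemannSum≤∑1/p {xs = 0 ∷ _} ((qr , _) ∷ _) = ⊥-elim (¬prime[0] qr)
riemannSum≤∑1/p {xs = 1 ∷ _} ((qr , _) ∷ _) = ⊥-elim (¬prime[1] qr)
riemannSum≤∑1/p {xs = 2 ∷ _} (pd ∷ pxs) _ pr (p≤2 ∷ _) N = ≤-trans (riemannSum≤-even pd pxs N)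
  (+-monoʳ-≤ (∑1/p (pd ∷ pxs)) (*-monoˡ-≤-nonNeg (+ 25 / 64) (1/prime-antitone pr p≤2)))
riemannSum≤∑1/p {xs = suc (suc (suc q)) ∷ _} pxs xs↗@(q<xs ∷ _) pr (p≤q ∷ _) N = ≤-trans
  (riemannSum≤-odd pxs (3≤q ∷ All.map (ℕ.≤-trans 3≤q ∘ ℕ.<⇒≤) q<xs) N)
  (+-monoʳ-≤ (∑1/p pxs) (≤-trans (∑excess≤25/64 xs↗ (All.map proj₁ pxs) 3≤q)
    (*-monoˡ-≤-nonNeg (+ 25 / 64) (1/prime-antitone pr p≤q))))
  where
  3≤q : 3 ℕ.≤ 3 ℕ.+ q
  3≤q = ℕ.s≤s (ℕ.s≤s (ℕ.s≤s ℕ.z≤n))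

proposition4 : ∀ (n : ℕ) → PrimitiveNonDeficient n →
    ∀ (k : ℕ) (p a : Vector ℕ (suc k)) (fac : IsPrimeFactorization n p a) →
    let S        = surplus n
        p₁-prime = IsPrimeFactorization.prime fac zero
    in fromℚ (T n)
    ≥ℝ log (+ 2 / 1)
    -ℝ fromℚ ((+ 25 / 64) * 1/prime {p zero} p₁-prime)
    +ℝ fromℚ (S * (+ 1 / 2))
    -ℝ fromℚ (S * S * (+ 1 / 4))
-- The order on ℝ asks each approximant of the difference to be at least `- ε m`. Here each is even
-- nonnegative, because the bound holds for every Riemann sum of log 2.
proposition4 n _ k p a fac m = ≤-trans (neg-antimono-≤ (0≤ε m)) (subst (0ℚ ≤_)
  (solve 4 (λ R S T A → let s = S :* con ½ in T :+ A :- (R :+ (s :- s :* s))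
     := T :- (R :- A :+ S :* con ½ :- S :* S :* con (+ 1 / 4))) refl
     (riemannSum (+ 2 / 1) N) (surplus n) (T n) ((+ 25 / 64) * 1/prime p₁-prime))
  (p≤q⇒0≤q-p (riemannSum≤∑1/p (primeDivisors-correct n) (primeDivisors-increasing n) p₁-prime
    (All.map (leastPrimeFactor≤ fac) (primeDivisors-correct n)) N)))
  where
  p₁-prime = IsPrimeFactorization.prime fac zero
  -- the index at which the four nested operations of ℝ evaluate the logarithm
  N = terms (+ 2 / 1) (dbl (dbl (dbl (dbl m))))
    where
    dbl : ℕ → ℕ
    dbl i = i ℕ.+ suc i
  instance
    N≢0 : ℕ.NonZero N
    N≢0 = terms-nonZero (+ 2 / 1) _
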